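{- Let $G$ be a connected graph. Then $G$ is $6$-periodic (that is, $G$ induces a $6$-periodic Grover walk) if and only if $G$ is isomorphic to a Dutch windmill graph $D_3^{(t)}$ for some integer $t\geq 2$ or to a uniform theta graph $\Theta(t,2)$ for some integer $t\geq 1$.
   Context: Graphs are simple and finite. For a graph $G=(V,E)$, let $d_x$ be the degree of a vertex $x$ and let $\mathcal{A}=\{(x,y),(y,x) \mid \{x,y\}\in E\}$ be the set of symmetric arcs. For an arc $a=(x,y)$ write $o(a)=x$ (origin), $t(a)=y$ (terminus) and $a^{ -1}=(y,x)$. The time evolution matrix of the Grover walk on $G$ is $U=U(G)\in\mathbb{C}^{\mathcal{A}\times\mathcal{A}}$ with entries \[ U_{a,b} = \frac{2}{d_{t(b)}}\,\delta_{o(a),t(b)} - \delta_{a,b^{ -1}}, \] where $\delta$ is the Kronecker delta. For a positive integer $\tau$, $G$ is called $\tau$-periodic if $\tau$ is the smallest positive integer with $U(G)^\tau = I$. The Dutch windmill graph $D_3^{(t)}$ is obtained from $t$ disjoint copies of the triangle $C_3$ by identifying one vertex from each copy into a single common vertex. The uniform theta graph $\Theta(t,2)$ is obtained from $t$ pairwise vertex-disjoint path graphs on $2$ vertices by adding two new vertices and, for each path, joining one endpoint to the first new vertex and the other endpoint to the second new vertex. -}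

module Defs where

open import Data.Bool.Base using (Bool; true; false; T; _∧_; not)
open import Data.Bool.Properties using (T?; T-irrelevant; T-≡)
open import Data.Fin.Base using (Fin; zero; suc)
open import Data.Fin.Properties using (_≟_)
open import Data.Fin.Subset using (Subset; _∈_; ∣_∣)
open import Data.Fin.Subset.Properties using (∣⁅x⁆∣≡1; x∈⁅y⁆⇒x≡y; p⊆q⇒∣p∣≤∣q∣)
open import Data.Integer.Base using (+_)
open import Data.Nat.Base as ℕ using (ℕ; zero; suc; NonZero; >-nonZero)
open import Data.Product.Base using (Σ-syntax; _×_; _,_)
open import Data.Rational.Base using (ℚ; 0ℚ; 1ℚ; _/_; _-_; _*_)
open import Data.Rational.Properties using (+-0-commutativeMonoid)
open import Data.Vec.Base using (tabulate)
open import Data.Vec.Properties using (lookup∘tabulate; lookup⇒[]=)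
open import Function.Base using (_∘_)
open import Function.Bundles using (_↔_; module Inverse; module Equivalence)
open import Level using (0ℓ)
open import Relation.Binary.Construct.Closure.ReflexiveTransitive using (Star)
open import Relation.Binary.Core using (Rel)
open import Relation.Binary.Definitions using (DecidableEquality)
open import Relation.Binary.PropositionalEquality using (_≡_; refl; sym; trans; cong; subst)
open import Relation.Nullary using (Dec; yes; no; does)

open import Algebra.Properties.CommutativeMonoid.Sum +-0-commutativeMonoid using (sum)

record Graph (V : Set) : Set where
  field
    adj    : V → V → Bool
    symm   : ∀ x y → adj x y ≡ adj y x
    irrefl : ∀ x → adj x x ≡ false

  _~_ : Rel V 0ℓ
  x ~ y = T (adj x y)

open Graph using (adj)

Connected : ∀ {V} → Graph V → Set
Connected {V} G = V × (∀ x y → Star (Graph._~_ G) x y)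

_≅_ : ∀ {V W} → Graph V → Graph W → Set
_≅_ {V} {W} G H =
  Σ[ f ∈ V ↔ W ] ∀ x y → adj G x y ≡ adj H (Inverse.to f x) (Inverse.to f y)

data WindmillVertex (t : ℕ) : Set where
  hub : WindmillVertex t
  rim : Fin t → Fin 2 → WindmillVertex t

-- The i-th triangle has vertices  hub , rim i 0 , rim i 1.
windmillAdj : ∀ {t} → WindmillVertex t → WindmillVertex t → Bool
windmillAdj hub       hub       = false
windmillAdj hub       (rim _ _) = true
windmillAdj (rim _ _) hub       = true
windmillAdj (rim i a) (rim j b) = does (i ≟ j) ∧ not (does (a ≟ b))

data ThetaVertex (t : ℕ) : Set where
  left  : ThetaVertex t
  right : ThetaVertex t
  inner : Fin t → Fin 2 → ThetaVertex t

-- The i-th path on two vertices is  inner i 0 , inner i 1 ; its endpoint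
-- inner i 0  is joined to  left  and its endpoint  inner i 1  to  right.
thetaAdj : ∀ {t} → ThetaVertex t → ThetaVertex t → Bool
thetaAdj left        (inner _ a) = does (a ≟ zero)
thetaAdj (inner _ a) left        = does (a ≟ zero)
thetaAdj right       (inner _ a) = does (a ≟ suc zero)
thetaAdj (inner _ a) right       = does (a ≟ suc zero)
thetaAdj (inner i a) (inner j b) = does (i ≟ j) ∧ not (does (a ≟ b))
thetaAdj left        left        = false
thetaAdj left        right       = false
thetaAdj right       left        = false
thetaAdj right       right       = false

private
  ≟-symm : ∀ {n} (x y : Fin n) → does (x ≟ y) ≡ does (y ≟ x)
  ≟-symm zero    zero    = refl
  ≟-symm zero    (suc _) = refl
  ≟-symm (suc _) zero    = refl
  ≟-symm (suc x) (suc y) = ≟-symm x y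

  pair-symm : ∀ {t} (i j : Fin t) (a b : Fin 2) →
    (does (i ≟ j) ∧ not (does (a ≟ b))) ≡ (does (j ≟ i) ∧ not (does (b ≟ a)))
  pair-symm i j a b rewrite ≟-symm i j | ≟-symm a b = refl

  pair-irrefl : ∀ {t} (i : Fin t) (a : Fin 2) →
    (does (i ≟ i) ∧ not (does (a ≟ a))) ≡ false
  pair-irrefl zero    zero       = refl
  pair-irrefl zero    (suc zero) = refl
  pair-irrefl (suc i) a          = pair-irrefl i a

DutchWindmill : (t : ℕ) → Graph (WindmillVertex t)
DutchWindmill t = record { adj = windmillAdj ; symm = symm ; irrefl = irrefl }
  where
  symm : ∀ x y → windmillAdj x y ≡ windmillAdj y x
  symm hub       hub       = refl
  symm hub       (rim _ _) = refl
  symm (rim _ _) hub       = refl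
  symm (rim i a) (rim j b) = pair-symm i j a b

  irrefl : ∀ x → windmillAdj x x ≡ false
  irrefl hub       = refl
  irrefl (rim i a) = pair-irrefl i a

UniformTheta₂ : (t : ℕ) → Graph (ThetaVertex t)
UniformTheta₂ t = record { adj = thetaAdj ; symm = symm ; irrefl = irrefl }
  where
  symm : ∀ x y → thetaAdj x y ≡ thetaAdj y x
  symm left        left        = refl
  symm left        right       = refl
  symm left        (inner _ _) = refl
  symm right       left        = refl
  symm right       right       = refl
  symm right       (inner _ _) = refl
  symm (inner _ _) left        = refl
  symm (inner _ _) right       = refl
  symm (inner i a) (inner j b) = pair-symm i j a b

  irrefl : ∀ x → thetaAdj x x ≡ false
  irrefl left        = refl
  irrefl right       = refl
  irrefl (inner i a) = pair-irrefl i a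

δ : {P : Set} → Dec P → ℚ
δ (yes _) = 1ℚ
δ (no _)  = 0ℚ

module Grover {n : ℕ} (G : Graph (Fin n)) where

  open Graph G using (_~_; symm)

  neighbours : Fin n → Subset n
  neighbours x = tabulate (adj G x)

  degree : Fin n → ℕ
  degree x = ∣ neighbours x ∣

  record Arc : Set where
    constructor arc
    field
      origin   : Fin n
      terminus : Fin n
      edge     : origin ~ terminus

  open Arc public

  reverse : Arc → Arc
  reverse (arc x y e) = arc y x (subst T (symm x y) e)

  _≟ₐ_ : DecidableEquality Arc
  arc x y e ≟ₐ arc x′ y′ e′ with x ≟ x′ | y ≟ y′
  ... | no x≢   | _      = no (x≢ ∘ cong origin)
  ... | yes _   | no y≢  = no (y≢ ∘ cong terminus)
  ... | yes refl | yes refl = yes (cong (arc x y) (T-irrelevant e e′))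

  degree-nonZero : ∀ {x y} → x ~ y → NonZero (degree x)
  degree-nonZero {x} {y} e = >-nonZero
    (subst (ℕ._≤ degree x) (∣⁅x⁆∣≡1 y) (p⊆q⇒∣p∣≤∣q∣ λ z∈ →
      subst (_∈ neighbours x) (sym (x∈⁅y⁆⇒x≡y y z∈))
        (lookup⇒[]= y (neighbours x)
          (trans (lookup∘tabulate (adj G x) y) (Equivalence.to T-≡ e)))))

  Matrix : Set
  Matrix = Arc → Arc → ℚ

  onEdge : (Arc → ℚ) → ∀ x y → Dec (x ~ y) → ℚ
  onEdge f x y (yes e) = f (arc x y e)
  onEdge f x y (no _)  = 0ℚ

  -- The arcs are enumerated as the pairs (x , y) of adjacent vertices.
  ∑ₐ : (Arc → ℚ) → ℚ
  ∑ₐ f = sum λ x → sum λ y → onEdge f x y (T? (adj G x y))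

  I : Matrix
  I a b = δ (a ≟ₐ b)

  _⊗_ : Matrix → Matrix → Matrix
  (M ⊗ N) a b = ∑ₐ λ c → M a c * N c b

  _^_ : Matrix → ℕ → Matrix
  M ^ zero  = I
  M ^ suc k = M ⊗ (M ^ k)

  _≈_ : Matrix → Matrix → Set
  M ≈ N = ∀ a b → M a b ≡ N a b

  -- All entries of the time evolution matrix are rational, so its powers,
  -- and the equation U ^ τ ≈ I, are the same over ℚ as over ℂ.
  U : Matrix
  U a b = (+ 2 / degree (terminus b)) * δ (origin a ≟ terminus b) - δ (a ≟ₐ reverse b)
    where instance _ = degree-nonZero (edge (reverse b))

Periodic : ∀ {n} → Graph (Fin n) → ℕ → Set
Periodic G τ =
  0 ℕ.< τ × (U ^ τ) ≈ I × (∀ k → 0 ℕ.< k → (U ^ k) ≈ I → τ ℕ.≤ k)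
  where open Grover G

{-# OPTIONS --safe #-}
module Submission where

-- The walk acts on functions F of ordered pairs of vertices by step F x y = 2 avg_x F(·, x) − F y x.
-- Conjugation by the reversal of arcs inverts it, so U⁶ = I says that U³ commutes with the reversal.
-- Computing U³ on point masses, with P the averaging operator and κ(x, y) the kernel of 4P² − 1
-- relative to the degree measure, that is κ(x, y) = (4 / d_x d_y) Σ_{u ~ x, y} 1/d_u − δ_xy / d_y, this becomes
--   κ(y, z) = κ(x, w)   for all edges x ~ y and w ~ z.
-- It holds on windmills, where κ is constant, and on theta graphs, where κ is constant on pairs in the
-- same colour class and 0 on the others.  Conversely the condition makes κ equal to one constant k > 0 on
-- all pairs at even distance, and hence determines Σ_{u ~ x, y} 1/d_u for these.  The diagonal case
-- produces a vertex of degree at most 3; positivity then rules out everything but a pair of adjacent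
-- vertices x, y of degree 2.  If their other neighbours agree, that neighbour is the hub of a windmill,
-- and otherwise they are the two ends of a theta graph.  Such a graph with an edge has
-- period less than 6 only if it is K₂ or C₃.

open import Defs
open import Data.Bool.Base using (Bool; true; false; T; _∧_; not)
open import Data.Bool.Properties using (T?; T-≡)
open import Data.Empty using (⊥; ⊥-elim)
open import Data.Fin.Base using (Fin; zero; suc; toℕ)
open import Data.Fin.Properties using (_≟_; toℕ-injective)
open import Data.Fin.Subset using (∣_∣)
open import Data.Integer.Base as ℤ using (+_)
import Data.Integer.Properties as ℤ
open import Data.List.Base using (List; []; _∷_; length; filter; tabulate; allFin; lookup; map)
open import Data.List.Membership.Propositional using (_∈_; find; lose)
open import Data.List.Membership.Propositional.Properties using (∈-filter⁺; ∈-filter⁻; ∈-allFin; ∈-lookup; ∈-map⁺; ∈-map⁻)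
open import Data.List.Membership.Propositional.Properties.WithK using (unique∧set⇒bag)
open import Data.List.Properties using (length-map; length-tabulate)
open import Data.List.Relation.Binary.BagAndSetEquality using (∼bag⇒↭)
open import Data.List.Relation.Binary.Permutation.Propositional as Perm using (_↭_; swap; ↭-refl; ↭-sym; ↭-trans; ↭⇒↭ₛ; ↭-reflexive)
open import Data.List.Relation.Binary.Permutation.Propositional.Properties using (∈-resp-↭; ↭-length)
import Data.List.Relation.Binary.Permutation.Setoid.Properties as Permutationₛ
open import Data.List.Relation.Unary.All as All using ([]; _∷_)
open import Data.List.Relation.Unary.AllPairs using ([]; _∷_)
open import Data.List.Relation.Unary.Any using (here; there; any?; index)
open import Data.List.Relation.Unary.Any.Properties using (lookup-index)
open import Data.List.Relation.Unary.Unique.Propositional using (Unique)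
import Data.List.Relation.Unary.Unique.Propositional.Properties as Unique
open import Data.Nat.Base as ℕ using (ℕ; zero; suc; _≥_)
import Data.Nat.Properties as ℕ
open import Data.Product.Base using (_,_; _×_; ∃-syntax; Σ-syntax; proj₁; proj₂)
open import Data.Rational.Base hiding (NonZero; ∣_∣; _≥_)
open import Data.Rational.Properties hiding (_≟_)
open import Data.Rational.Solver using (module +-*-Solver)
open import Data.Rational.Unnormalised.Base as ℚᵘ using (mkℚᵘ; *≡*)
import Data.Rational.Unnormalised.Properties as ℚᵘ
open import Data.Sum.Base using (_⊎_; inj₁; inj₂; [_,_]′)
open import Data.Vec.Base using () renaming (tabulate to tabulateᵛ)
open import Function.Base using (_∘_; id; flip)
open import Function.Bundles using (module Equivalence; _⇔_; mk⇔; mk↔ₛ′; Inverse)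
open import Relation.Binary.Construct.Closure.ReflexiveTransitive using (Star; ε; _◅_)
open import Relation.Binary.Definitions using (tri<; tri≈; tri>)
open import Relation.Binary.PropositionalEquality
open import Relation.Nullary using (Dec; yes; no; does; ¬_; contradiction)
open import Relation.Nullary.Decidable using (dec-true; dec-false; ¬?; _×-dec_; _⊎-dec_)
open import Algebra.Properties.CommutativeMonoid.Sum +-0-commutativeMonoid using (sum; sum-cong-≗)
open +-*-Solver

-- The polynomial 4P² - 1 is sin 3θ / sin θ at P = cos θ. The walk has eigenvalues exp(±iθ) over the
-- eigenvalues cos θ of P, so U⁶ = I asks for cos θ among ±1 and ±1/2. The polynomial vanishes at
-- ±1/2 and is 3 at ±1, where the eigenfunctions are the constants and, on a bipartite graph, the
-- sign of the colouring. This is why κ becomes constant on pairs of colour classes. The proof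
-- itself uses only identities between values on arcs, over ℚ. The passage from local to global
-- rests on k > 0: off the diagonal a positive κ requires a common neighbour, so two vertices at
-- even distance are at distance at most 2, and a pair of adjacent vertices of degree 2 already sees
-- the whole graph. The numerical cases are settled by certificates: a conclusion is the sum of
-- multiples of known equations and of visibly nonnegative terms, and the ring solver checks the
-- identity. Between the computation of κ and the isomorphisms stand the local descriptions
-- `IsWindmill` and `IsTheta`.

private variable
  A B : Set

-- Rational arithmetic and finite sums

2ℚ 3ℚ 4ℚ 8ℚ : ℚ
2ℚ = + 2 / 1
3ℚ = + 3 / 1
4ℚ = + 4 / 1
8ℚ = + 8 / 1

fromℚᵘ-homo-* : ∀ p q → fromℚᵘ p * fromℚᵘ q ≡ fromℚᵘ (p ℚᵘ.* q)
fromℚᵘ-homo-* p q = toℚᵘ-injective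
  (ℚᵘ.≃-trans (toℚᵘ-homo-* (fromℚᵘ p) (fromℚᵘ q))
  (ℚᵘ.≃-trans (ℚᵘ.*-cong (toℚᵘ-fromℚᵘ p) (toℚᵘ-fromℚᵘ q)) (ℚᵘ.≃-sym (toℚᵘ-fromℚᵘ (p ℚᵘ.* q)))))

fromℚᵘ-homo-+ : ∀ p q → fromℚᵘ p + fromℚᵘ q ≡ fromℚᵘ (p ℚᵘ.+ q)
fromℚᵘ-homo-+ p q = toℚᵘ-injective
  (ℚᵘ.≃-trans (toℚᵘ-homo-+ (fromℚᵘ p) (fromℚᵘ q))
  (ℚᵘ.≃-trans (ℚᵘ.+-cong (toℚᵘ-fromℚᵘ p) (toℚᵘ-fromℚᵘ q)) (ℚᵘ.≃-sym (toℚᵘ-fromℚᵘ (p ℚᵘ.+ q)))))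

fromℕ : ℕ → ℚ
fromℕ zero    = 0ℚ
fromℕ (suc k) = 1ℚ + fromℕ k

-- With the junk value 0 at 0.
inv : ℕ → ℚ
inv zero    = 0ℚ
inv (suc k) = + 1 / suc k

fromℕ≡/1 : ∀ k → fromℕ k ≡ + k / 1
fromℕ≡/1 zero    = refl
fromℕ≡/1 (suc k) = trans (cong (λ q → 1ℚ + q) (fromℕ≡/1 k))
  (trans (fromℚᵘ-homo-+ (mkℚᵘ (+ 1) 0) (mkℚᵘ (+ k) 0))
         (fromℚᵘ-cong {mkℚᵘ (+ 1) 0 ℚᵘ.+ mkℚᵘ (+ k) 0} {mkℚᵘ (+ suc k) 0}
           (*≡* (cong (λ z → (+ 1 ℤ.+ z) ℤ.* + 1) (ℤ.*-identityʳ (+ k))))))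

fromℕ*/ : ∀ a k → fromℕ (suc k) * (+ a / suc k) ≡ fromℕ a
fromℕ*/ a k = trans (cong (λ q → q * (+ a / suc k)) (fromℕ≡/1 (suc k)))
  (trans (fromℚᵘ-homo-* (mkℚᵘ (+ suc k) 0) (mkℚᵘ (+ a) k))
  (trans (fromℚᵘ-cong {mkℚᵘ (+ suc k) 0 ℚᵘ.* mkℚᵘ (+ a) k} {mkℚᵘ (+ a) 0}
           (*≡* (trans (ℤ.*-identityʳ _) (trans (ℤ.*-comm (+ suc k) (+ a))
             (cong (λ z → + a ℤ.* + suc z) (sym (ℕ.+-identityʳ k)))))))
         (sym (fromℕ≡/1 a))))

fromℕ*inv : ∀ k → k ≢ 0 → fromℕ k * inv k ≡ 1ℚ
fromℕ*inv zero    0≢0 = contradiction refl 0≢0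
fromℕ*inv (suc k) _   = fromℕ*/ 1 k

2/≡2*inv : ∀ k .{{_ : ℕ.NonZero k}} → + 2 / k ≡ 2ℚ * inv k
2/≡2*inv (suc k) = begin
  p                               ≡⟨ *-identityˡ p ⟨
  1ℚ * p                          ≡⟨ cong (λ q → q * p) (fromℕ*/ 1 k) ⟨
  (fromℕ (suc k) * q) * p         ≡⟨ solve 3 (λ n i t → (n :* i) :* t := (n :* t) :* i) refl (fromℕ (suc k)) q p ⟩
  (fromℕ (suc k) * p) * q         ≡⟨ cong (λ r → r * q) (fromℕ*/ 2 k) ⟩
  2ℚ * q                          ∎
  where
  open ≡-Reasoning
  p = + 2 / suc k
  q = + 1 / suc k

0≤+ : ∀ {p q} → 0ℚ ≤ p → 0ℚ ≤ q → 0ℚ ≤ p + q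
0≤+ = +-mono-≤

0≤* : ∀ {p q} → 0ℚ ≤ p → 0ℚ ≤ q → 0ℚ ≤ p * q
0≤* {p} {q} 0≤p 0≤q =
  nonNegative⁻¹ (p * q) {{nonNeg*nonNeg⇒nonNeg p {{nonNegative 0≤p}} q {{nonNegative 0≤q}}}}

0<* : ∀ {p q} → 0ℚ < p → 0ℚ < q → 0ℚ < p * q
0<* {p} {q} 0<p 0<q = positive⁻¹ (p * q) {{pos*pos⇒pos p {{positive 0<p}} q {{positive 0<q}}}}

-- A Positivstellensatz certificate.
0<+0≤≢0 : ∀ {p q} → 0ℚ < p → 0ℚ ≤ q → p + q ≢ 0ℚ
0<+0≤≢0 0<p 0≤q eq = <-irrefl (sym eq) (+-mono-<-≤ 0<p 0≤q)

≤⇒0≤- : ∀ {p q} → p ≤ q → 0ℚ ≤ q - p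
≤⇒0≤- {p} {q} p≤q = subst (λ r → r ≤ q - p) (+-inverseʳ p) (+-monoˡ-≤ (- p) p≤q)

*-zero-product : ∀ {p q} → 0ℚ < p → p * q ≡ 0ℚ → q ≡ 0ℚ
*-zero-product {p} {q} 0<p pq≡0 = *-cancelˡ-≡ (trans pq≡0 (sym (*-zeroʳ p)))
  where
  instance _ = >-nonZero 0<p
  *-cancelˡ-≡ : p * q ≡ p * 0ℚ → q ≡ 0ℚ
  *-cancelˡ-≡ eq = trans (sym (*-identityˡ q)) (trans (cong (λ r → r * q) (sym (*-inverseˡ p)))
    (trans (*-assoc (1/ p) p q) (trans (cong (λ r → (1/ p) * r) (trans eq (*-zeroʳ p))) (*-zeroʳ (1/ p)))))

vanish : ∀ {l r} c → l ≡ r → c * (l - r) ≡ 0ℚ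
vanish {l} c refl = trans (cong (λ q → c * q) (+-inverseʳ l)) (*-zeroʳ c)

-- An equation is deduced by exhibiting it as a linear combination of known ones.
by₁ : ∀ {x y l r} c → l ≡ r → x ≡ y + c * (l - r) → x ≡ y
by₁ {y = y} c h eq = trans eq (trans (cong (λ q → y + q) (vanish c h)) (+-identityʳ y))

by₂ : ∀ {x y l₁ r₁ l₂ r₂} c₁ → l₁ ≡ r₁ → ∀ c₂ → l₂ ≡ r₂ →
      x ≡ y + c₁ * (l₁ - r₁) + c₂ * (l₂ - r₂) → x ≡ y
by₂ c₁ h₁ c₂ h₂ eq = by₁ c₁ h₁ (by₁ c₂ h₂ eq)

by₃ : ∀ {x y l₁ r₁ l₂ r₂ l₃ r₃} c₁ → l₁ ≡ r₁ → ∀ c₂ → l₂ ≡ r₂ → ∀ c₃ → l₃ ≡ r₃ →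
      x ≡ y + c₁ * (l₁ - r₁) + c₂ * (l₂ - r₂) + c₃ * (l₃ - r₃) → x ≡ y
by₃ c₁ h₁ c₂ h₂ c₃ h₃ eq = by₂ c₁ h₁ c₂ h₂ (by₁ c₃ h₃ eq)

0<fromℕ : ∀ k → 0ℚ < fromℕ (suc k)
0≤fromℕ : ∀ k → 0ℚ ≤ fromℕ k
0<fromℕ k = +-mono-<-≤ {0ℚ} {1ℚ} (positive⁻¹ 1ℚ) (0≤fromℕ k)
0≤fromℕ zero    = ≤-refl
0≤fromℕ (suc k) = <⇒≤ (0<fromℕ k)

0≤inv : ∀ k → 0ℚ ≤ inv k
0≤inv zero    = ≤-refl
0≤inv (suc k) = nonNegative⁻¹ (+ 1 / suc k) {{normalize-nonNeg 1 (suc k)}}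

0<inv : ∀ {k} → k ≢ 0 → 0ℚ < inv k
0<inv {zero}  0≢0 = contradiction refl 0≢0
0<inv {suc k} _   = positive⁻¹ (+ 1 / suc k) {{normalize-pos 1 (suc k)}}

fromℕ-mono : ∀ {j k} → j ℕ.≤ k → fromℕ j ≤ fromℕ k
fromℕ-mono {k = k} ℕ.z≤n = 0≤fromℕ k
fromℕ-mono (ℕ.s≤s j≤k)   = +-monoʳ-≤ 1ℚ (fromℕ-mono j≤k)

-- Multiply j ≤ k by 1/(jk). The condition on j keeps out the junk value at 0.
inv-anti : ∀ {j k} → j ≢ 0 → j ℕ.≤ k → inv k ≤ inv j
inv-anti {zero} j≢0 _ = contradiction refl j≢0
inv-anti {suc j} {k} j≢0 j≤k = subst₂ _≤_ eq₁ eq₂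
  (*-monoʳ-≤-nonNeg c {{nonNegative (0≤* (0≤inv (suc j)) (0≤inv k))}} (fromℕ-mono j≤k))
  where
  k≢0 : k ≢ 0
  k≢0 refl = ℕ.n≮0 j≤k
  c = inv (suc j) * inv k
  eq₁ : fromℕ (suc j) * c ≡ inv k
  eq₁ = by₁ (inv k) (fromℕ*inv (suc j) j≢0)
    (solve 3 (λ n i l → n :* (i :* l) := l :+ l :* (n :* i :- con 1ℚ)) refl (fromℕ (suc j)) (inv (suc j)) (inv k))
  eq₂ : fromℕ k * c ≡ inv (suc j)
  eq₂ = by₁ (inv (suc j)) (fromℕ*inv k k≢0)
    (solve 3 (λ n i l → n :* (i :* l) := i :+ i :* (n :* l :- con 1ℚ)) refl (fromℕ k) (inv (suc j)) (inv k))

ind : Bool → ℚ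
ind true  = 1ℚ
ind false = 0ℚ

0≤ind : ∀ b → 0ℚ ≤ ind b
0≤ind true  = nonNegative⁻¹ 1ℚ
0≤ind false = ≤-refl

∑ : List A → (A → ℚ) → ℚ
∑ []       f = 0ℚ
∑ (x ∷ xs) f = f x + ∑ xs f

∑-cong : ∀ {f g : A → ℚ} xs → (∀ x → x ∈ xs → f x ≡ g x) → ∑ xs f ≡ ∑ xs g
∑-cong []       f≗g = refl
∑-cong (x ∷ xs) f≗g = cong₂ _+_ (f≗g x (here refl)) (∑-cong xs λ y y∈ → f≗g y (there y∈))

∑-+ : ∀ (f g : A → ℚ) xs → ∑ xs (λ x → f x + g x) ≡ ∑ xs f + ∑ xs g
∑-+ f g []       = refl
∑-+ f g (x ∷ xs) = trans (cong (λ q → f x + g x + q) (∑-+ f g xs))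
  (solve 4 (λ a b c d → a :+ b :+ (c :+ d) := (a :+ c) :+ (b :+ d)) refl (f x) (g x) (∑ xs f) (∑ xs g))

∑-* : ∀ c (f : A → ℚ) xs → ∑ xs (λ x → c * f x) ≡ c * ∑ xs f
∑-* c f []       = sym (*-zeroʳ c)
∑-* c f (x ∷ xs) = trans (cong (λ q → c * f x + q) (∑-* c f xs)) (sym (*-distribˡ-+ c (f x) (∑ xs f)))

∑-const : ∀ c (xs : List A) → ∑ xs (λ _ → c) ≡ fromℕ (length xs) * c
∑-const c []       = sym (*-zeroˡ c)
∑-const c (x ∷ xs) = trans (cong (λ q → c + q) (∑-const c xs))
  (solve 2 (λ c n → c :+ n :* c := (con 1ℚ :+ n) :* c) refl c (fromℕ (length xs)))

∑-↭ : ∀ (f : A → ℚ) {xs ys} → xs ↭ ys → ∑ xs f ≡ ∑ ys f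
∑-↭ f Perm.refl              = refl
∑-↭ f (Perm.prep x p)        = cong (λ q → f x + q) (∑-↭ f p)
∑-↭ f (swap {ys = ys} x y p) = trans (cong (λ q → f x + (f y + q)) (∑-↭ f p))
  (solve 3 (λ a b c → a :+ (b :+ c) := b :+ (a :+ c)) refl (f x) (f y) (∑ ys f))
∑-↭ f (Perm.trans p q)       = trans (∑-↭ f p) (∑-↭ f q)

∑-mono : ∀ {f g : A → ℚ} xs → (∀ x → x ∈ xs → f x ≤ g x) → ∑ xs f ≤ ∑ xs g
∑-mono []       f≤g = ≤-refl
∑-mono (x ∷ xs) f≤g = +-mono-≤ (f≤g x (here refl)) (∑-mono xs λ y y∈ → f≤g y (there y∈))

0≤∑ : ∀ {f : A → ℚ} xs → (∀ x → 0ℚ ≤ f x) → 0ℚ ≤ ∑ xs f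
0≤∑ []       0≤f = ≤-refl
0≤∑ (x ∷ xs) 0≤f = 0≤+ (0≤f x) (0≤∑ xs 0≤f)

∈⇒≤∑ : ∀ {f : A → ℚ} {x xs} → (∀ x → 0ℚ ≤ f x) → x ∈ xs → f x ≤ ∑ xs f
∈⇒≤∑ {f = f} {x} {_ ∷ xs} 0≤f (here refl) =
  subst (λ q → q ≤ f x + ∑ xs f) (+-identityʳ (f x)) (+-monoʳ-≤ (f x) (0≤∑ xs 0≤f))
∈⇒≤∑ {f = f} {x} {y ∷ xs} 0≤f (there x∈) =
  subst (λ q → q ≤ f y + ∑ xs f) (+-identityˡ (f x)) (+-mono-≤ (0≤f y) (∈⇒≤∑ 0≤f x∈))

∑-filter : ∀ {P : A → Set} (P? : ∀ x → Dec (P x)) (f : A → ℚ) xs →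
  ∑ (filter P? xs) f ≡ ∑ xs (λ x → ind (does (P? x)) * f x)
∑-filter P? f []       = refl
∑-filter P? f (x ∷ xs) with does (P? x)
... | true  = cong₂ _+_ (sym (*-identityˡ (f x))) (∑-filter P? f xs)
... | false = trans (∑-filter P? f xs) (trans (sym (+-identityˡ _)) (cong (λ q → q + _) (sym (*-zeroˡ (f x)))))

δ-ind : ∀ {P : Set} (d : Dec P) → δ d ≡ ind (does d)
δ-ind (yes _) = refl
δ-ind (no _)  = refl

≟-sym : ∀ {n} (x y : Fin n) → does (x ≟ y) ≡ does (y ≟ x)
≟-sym x y with x ≟ y
... | yes refl = sym (dec-true (y ≟ y) refl)
... | no x≢y   = sym (dec-false (y ≟ x) (x≢y ∘ sym))

∑-tabulate : ∀ {n} {A : Set} (g : Fin n → A) f → ∑ (tabulate g) f ≡ sum (f ∘ g)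
∑-tabulate {zero}  g f = refl
∑-tabulate {suc n} g f = cong (λ q → f (g zero) + q) (∑-tabulate (g ∘ suc) f)

∑-zero : ∀ {A : Set} {f : A → ℚ} xs → (∀ x → x ∈ xs → f x ≡ 0ℚ) → ∑ xs f ≡ 0ℚ
∑-zero []       f≗0 = refl
∑-zero (x ∷ xs) f≗0 = trans (cong₂ _+_ (f≗0 x (here refl)) (∑-zero xs λ y y∈ → f≗0 y (there y∈))) (+-identityˡ 0ℚ)

sum-zero : ∀ {n} (f : Fin n → ℚ) → (∀ x → f x ≡ 0ℚ) → sum f ≡ 0ℚ
sum-zero {zero}  f f≗0 = refl
sum-zero {suc n} f f≗0 = trans (cong₂ _+_ (f≗0 zero) (sum-zero (f ∘ suc) (f≗0 ∘ suc))) (+-identityˡ 0ℚ)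

sum-ind : ∀ {n} (p : Fin n) (f : Fin n → ℚ) → sum (λ y → ind (does (p ≟ y)) * f y) ≡ f p
sum-ind zero    f = trans (cong₂ _+_ (*-identityˡ (f zero)) (sum-zero _ λ y → *-zeroˡ (f (suc y)))) (+-identityʳ (f zero))
sum-ind (suc p) f = trans (cong₂ _+_ (*-zeroˡ (f zero)) (sum-ind p (f ∘ suc))) (+-identityˡ (f (suc p)))

∑-ind : ∀ {n} (p : Fin n) (f : Fin n → ℚ) → ∑ (allFin n) (λ y → ind (does (p ≟ y)) * f y) ≡ f p
∑-ind p f = trans (∑-tabulate id λ y → ind (does (p ≟ y)) * f y) (sum-ind p f)

-- Links the degree of the statement, the size of a subset, to the length of a neighbour list.
∣tabulate∣ : ∀ {n} {A : Set} (p : A → Bool) (g : Fin n → A) →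
  ∣ tabulateᵛ (p ∘ g) ∣ ≡ length (filter (T? ∘ p) (tabulate g))
∣tabulate∣ {zero}  p g = refl
∣tabulate∣ {suc n} p g with p (g zero)
... | true  = cong suc (∣tabulate∣ p (g ∘ suc))
... | false = ∣tabulate∣ p (g ∘ suc)

fromℕ≡2⇒≡2 : ∀ d → fromℕ d ≡ 2ℚ → d ≡ 2
fromℕ≡2⇒≡2 (suc (suc zero)) _ = refl
fromℕ≡2⇒≡2 (suc (suc (suc d))) eq = contradiction
  (by₁ 1ℚ eq (solve 1 (λ m → con 1ℚ :+ m := con 0ℚ :+ con 1ℚ :* (con 1ℚ :+ (con 1ℚ :+ (con 1ℚ :+ m)) :- con 2ℚ)) refl (fromℕ d)))
  (0<+0≤≢0 (positive⁻¹ 1ℚ) (0≤fromℕ d))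

-- Isomorphisms and perfect matchings

-- Isomorphisms are given as maps out of the model graph, whose vertices can be matched on; the
-- witnesses of surjectivity supply the inverse.
≅-from : ∀ {V W} (G : Graph V) (H : Graph W) (from : W → V) →
  (∀ {p q} → from p ≡ from q → p ≡ q) → (∀ v → ∃[ p ] from p ≡ v) →
  (∀ p q → Graph.adj G (from p) (from q) ≡ Graph.adj H p q) → G ≅ H
≅-from G H from injective surjective adj-eq =
  mk↔ₛ′ to from (λ p → injective (from∘to (from p))) from∘to ,
  λ x y → trans (sym (cong₂ (Graph.adj G) (from∘to x) (from∘to y))) (adj-eq (to x) (to y))
  where
  to = λ v → proj₁ (surjective v)
  from∘to : ∀ v → from (to v) ≡ v
  from∘to v = proj₂ (surjective v)

other : Fin 2 → Fin 2
other zero       = suc zero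
other (suc zero) = zero

≢⇒other : ∀ {a b : Fin 2} → a ≢ b → b ≡ other a
≢⇒other {zero}     {zero}     a≢b = contradiction refl a≢b
≢⇒other {zero}     {suc zero} a≢b = refl
≢⇒other {suc zero} {zero}     a≢b = refl
≢⇒other {suc zero} {suc zero} a≢b = contradiction refl a≢b

≢other : ∀ (a : Fin 2) → a ≢ other a
≢other zero       ()
≢other (suc zero) ()

matchedAdj : ∀ {t} → Fin t → Fin 2 → Fin t → Fin 2 → Bool
matchedAdj i a j b = does (i ≟ j) ∧ not (does (a ≟ b))

matchedAdj⇒ : ∀ {t} (i : Fin t) a j b → T (matchedAdj i a j b) → j ≡ i × b ≡ other a
matchedAdj⇒ i a j b e with i ≟ j | a ≟ b
... | yes refl | no a≢b = refl , ≢⇒other a≢b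

matchedAdj-other : ∀ {t} (i : Fin t) a → matchedAdj i a i (other a) ≡ true
matchedAdj-other i a = cong₂ (λ p q → p ∧ not q) (dec-true (i ≟ i) refl) (dec-false (a ≟ other a) (≢other a))

≡true : ∀ {b} → T b → b ≡ true
≡true = Equivalence.to T-≡

≡false : ∀ {b} → ¬ T b → b ≡ false
≡false {true}  ¬b = ⊥-elim (¬b _)
≡false {false} ¬b = refl

-- Deciding `P` makes the choice independent of the proof of `P x`; outside `P` the value x is a
-- mere default.
choose : ∀ {A : Set} {P : A → Set} {Q : A → A → Set} → (∀ x → Dec (P x)) → (∀ {x} → P x → ∃[ y ] Q x y) →
  Σ[ f ∈ (A → A) ] (∀ {x} → P x → Q x (f x))
choose {A} {P} {Q} P? pick = f , good
  where
  f : A → A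
  f x with P? x
  ... | yes px = proj₁ (pick px)
  ... | no _   = x
  good : ∀ {x} → P x → Q x (f x)
  good {x} px with P? x
  ... | yes px′ = proj₂ (pick px′)
  ... | no ¬px  = contradiction px ¬px

lookup-injective : ∀ {A : Set} {xs : List A} → Unique xs → ∀ i j → lookup xs i ≡ lookup xs j → i ≡ j
lookup-injective (_ ∷ _)    zero    zero    _  = refl
lookup-injective (x∉ ∷ _)   zero    (suc j) eq = contradiction eq (All.lookup x∉ (∈-lookup j))
lookup-injective (x∉ ∷ _)   (suc i) zero    eq = contradiction (sym eq) (All.lookup x∉ (∈-lookup i))
lookup-injective (_ ∷ xs!)  (suc i) (suc j) eq = cong suc (lookup-injective xs! i j eq)

-- A perfect matching σ on the vertices satisfying Ord, enumerated by one representative of each edge.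
record Matching {n : ℕ} (G : Graph (Fin n)) (Ord : Fin n → Set) : Set where
  open Graph G using (_~_)
  field
    reps      : List (Fin n)
    unique    : Unique reps
    σ         : Fin n → Fin n
    σ-edge    : ∀ {w} → Ord w → w ~ σ w
    σ-ord     : ∀ {w} → Ord w → Ord (σ w)
    σ-only    : ∀ {w u} → Ord w → Ord u → w ~ u → u ≡ σ w
    reps-ord  : ∀ {w} → w ∈ reps → Ord w
    split     : ∀ {w} → Ord w → w ∈ reps ⊎ σ w ∈ reps
    exclusive : ∀ {w} → w ∈ reps → ¬ σ w ∈ reps

  t : ℕ
  t = length reps

  σσ : ∀ {w} → Ord w → σ (σ w) ≡ w
  σσ {w} o = sym (σ-only (σ-ord o) o (subst T (Graph.symm G w (σ w)) (σ-edge o)))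

  slot : Fin t → Fin 2 → Fin n
  slot i zero       = lookup reps i
  slot i (suc zero) = σ (lookup reps i)

  lookup-ord : ∀ i → Ord (lookup reps i)
  lookup-ord i = reps-ord (∈-lookup i)

  slot-ord : ∀ i a → Ord (slot i a)
  slot-ord i zero       = lookup-ord i
  slot-ord i (suc zero) = σ-ord (lookup-ord i)

  slot-other : ∀ i a → σ (slot i a) ≡ slot i (other a)
  slot-other i zero       = refl
  slot-other i (suc zero) = σσ (lookup-ord i)

  slot-injective : ∀ i a j b → slot i a ≡ slot j b → i ≡ j × a ≡ b
  slot-injective i zero       j zero       eq = lookup-injective unique i j eq , refl
  slot-injective i zero       j (suc zero) eq = ⊥-elim (exclusive (∈-lookup j) (subst (_∈ reps) eq (∈-lookup i)))
  slot-injective i (suc zero) j zero       eq = ⊥-elim (exclusive (∈-lookup i) (subst (_∈ reps) (sym eq) (∈-lookup j)))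
  slot-injective i (suc zero) j (suc zero) eq =
    lookup-injective unique i j (trans (sym (σσ (lookup-ord i))) (trans (cong σ eq) (σσ (lookup-ord j)))) , refl

  slot-surjective : ∀ {w} → Ord w → ∃[ i ] ∃[ a ] slot i a ≡ w
  slot-surjective o with split o
  ... | inj₁ w∈  = index w∈ , zero , sym (lookup-index w∈)
  ... | inj₂ σw∈ = index σw∈ , suc zero , trans (cong σ (sym (lookup-index σw∈))) (σσ o)

  -- By `σ-only` the matching edges are the only ones inside `Ord`. Both model graphs have this
  -- block of adjacencies.
  slot-adj : ∀ i a j b → Graph.adj G (slot i a) (slot j b) ≡ matchedAdj i a j b
  slot-adj i a j b with i ≟ j | a ≟ b
  ... | yes refl | yes refl = Graph.irrefl G (slot i a)
  ... | yes refl | no a≢b   = ≡true (subst (slot i a ~_) (trans (slot-other i a) (cong (slot i) (sym (≢⇒other a≢b)))) (σ-edge (slot-ord i a)))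
  ... | no i≢j   | _        = ≡false λ e → i≢j (proj₁ (slot-injective i (other a) j b
                                (trans (sym (slot-other i a)) (sym (σ-only (slot-ord i a) (slot-ord j b) e)))))

-- The walk on pairs of vertices

module Walk {n : ℕ} (G : Graph (Fin n)) where

  open Graph G
  open Grover G

  nbrs : Fin n → List (Fin n)
  nbrs x = filter (T? ∘ adj x) (allFin n)

  deg : Fin n → ℕ
  deg x = length (nbrs x)

  degree≡deg : ∀ x → degree x ≡ deg x
  degree≡deg x = ∣tabulate∣ (adj x) id

  ~-sym : ∀ {x y} → x ~ y → y ~ x
  ~-sym {x} {y} = subst T (symm x y)

  ~-irrefl : ∀ {x y} → x ~ y → x ≢ y
  ~-irrefl {x} x~x refl = subst T (irrefl x) x~x

  ∈⇒~ : ∀ {x y} → y ∈ nbrs x → x ~ y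
  ∈⇒~ {x} y∈ = proj₂ (∈-filter⁻ (T? ∘ adj x) {xs = allFin n} y∈)

  ~⇒∈ : ∀ {x y} → x ~ y → y ∈ nbrs x
  ~⇒∈ {x} {y} x~y = ∈-filter⁺ (T? ∘ adj x) (∈-allFin y) x~y

  nbrs-unique : ∀ x → Unique (nbrs x)
  nbrs-unique x = Unique.filter⁺ (T? ∘ adj x) (Unique.allFin⁺ n)

  ∑-nbrs : ∀ x f → ∑ (nbrs x) f ≡ ∑ (allFin n) (λ y → ind (adj x y) * f y)
  ∑-nbrs x f = ∑-filter (T? ∘ adj x) f (allFin n)

  D I₁ : Fin n → ℚ
  D  x = fromℕ (deg x)
  I₁ x = inv (deg x)

  avg : Fin n → (Fin n → ℚ) → ℚ
  avg x f = I₁ x * ∑ (nbrs x) f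

  -- Total on pairs, so that no edge proofs have to be carried along; only the values on arcs matter
  -- later.
  PairFunction : Set
  PairFunction = Fin n → Fin n → ℚ

  step : PairFunction → PairFunction
  step F x y = 2ℚ * avg x (λ u → F u x) - F y x

  onEdge-ind : ∀ (f : Arc → ℚ) x y h (d : Dec (x ~ y)) → (∀ e → f (arc x y e) ≡ h) →
    onEdge f x y d ≡ ind (does d) * h
  onEdge-ind f x y h (yes e) eq = trans (eq e) (sym (*-identityˡ h))
  onEdge-ind f x y h (no _)  eq = sym (*-zeroˡ h)

  δ-arc : ∀ a b → δ (a ≟ₐ b) ≡ ind (does (origin a ≟ origin b)) * ind (does (terminus a ≟ terminus b))
  δ-arc (arc x y e) (arc x′ y′ e′) with x ≟ x′ | y ≟ y′
  ... | no _     | d        = sym (*-zeroˡ (ind (does d)))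
  ... | yes _    | no _     = sym (*-zeroʳ 1ℚ)
  ... | yes refl | yes refl = refl

  -- Both terms of U vanish unless a starts where c ends, so this factor comes out.
  U-entry : ∀ a c → let p = origin a ; q = terminus a ; x = origin c ; y = terminus c in
    U a c ≡ ind (does (p ≟ y)) * (2ℚ * I₁ y - ind (does (q ≟ x)))
  U-entry a c = begin
    U a c                            ≡⟨ cong₂ (λ r s → r * s - δ (a ≟ₐ reverse c)) 2/deg (δ-ind (p ≟ y)) ⟩
    2ℚ * I₁ y * i - δ (a ≟ₐ reverse c) ≡⟨ cong (λ r → 2ℚ * I₁ y * i - r) (δ-arc a (reverse c)) ⟩
    2ℚ * I₁ y * i - i * j              ≡⟨ solve 3 (λ t i j → t :* i :- i :* j := i :* (t :- j)) refl (2ℚ * I₁ y) i j ⟩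
    i * (2ℚ * I₁ y - j)                ∎
    where
    open ≡-Reasoning
    p = origin a
    q = terminus a
    x = origin c
    y = terminus c
    i = ind (does (p ≟ y))
    j = ind (does (q ≟ x))
    instance _ = degree-nonZero (edge (reverse c))
    2/deg : + 2 / degree y ≡ 2ℚ * I₁ y
    2/deg = trans (2/≡2*inv (degree y)) (cong (λ k → 2ℚ * inv k) (degree≡deg y))

  -- In the double sum over pairs (x, y) the factor [p = y] collapses the inner sum. The outer one
  -- is then a sum over the neighbours of p, minus the single term x = q.
  U-action : ∀ F a → ∑ₐ (λ c → U a c * F (origin c) (terminus c)) ≡ step F (origin a) (terminus a)
  U-action F a = begin
    ∑ₐ (λ c → U a c * F (origin c) (terminus c))
      ≡⟨ ∑-tabulate id column ⟨
    ∑ (allFin n) column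
      ≡⟨ ∑-cong (allFin n) (λ x _ → columnSum x) ⟩
    ∑ (allFin n) (λ x → t * (ind (adj p x) * F x p) + (- 1ℚ) * (ind (does (q ≟ x)) * (ind (adj p x) * F x p)))
      ≡⟨ ∑-+ _ _ (allFin n) ⟩
    ∑ (allFin n) (λ x → t * (ind (adj p x) * F x p)) + ∑ (allFin n) (λ x → (- 1ℚ) * (ind (does (q ≟ x)) * (ind (adj p x) * F x p)))
      ≡⟨ cong₂ _+_ (∑-* t _ (allFin n)) (∑-* (- 1ℚ) _ (allFin n)) ⟩
    t * ∑ (allFin n) (λ x → ind (adj p x) * F x p) + (- 1ℚ) * ∑ (allFin n) (λ x → ind (does (q ≟ x)) * (ind (adj p x) * F x p))
      ≡⟨ cong₂ (λ r s → t * r + (- 1ℚ) * s) (sym (∑-nbrs p (λ u → F u p)))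
           (trans (∑-ind q _) (cong (λ b → ind b * F q p) (Equivalence.to T-≡ (edge a)))) ⟩
    t * ∑ (nbrs p) (λ u → F u p) + (- 1ℚ) * (1ℚ * F q p)
      ≡⟨ solve 3 (λ i s f → con 2ℚ :* i :* s :+ con (- 1ℚ) :* (con 1ℚ :* f) := con 2ℚ :* (i :* s) :- f) refl
           (I₁ p) (∑ (nbrs p) (λ u → F u p)) (F q p) ⟩
    step F p q ∎
    where
    open ≡-Reasoning
    p = origin a
    q = terminus a
    t = 2ℚ * I₁ p
    term : ∀ x y → ℚ
    term x y = ind (adj x y) * (2ℚ * I₁ y - ind (does (q ≟ x))) * F x y
    summand : ∀ x y → ℚ
    summand x y = onEdge (λ c → U a c * F (origin c) (terminus c)) x y (T? (adj x y))
    column : ∀ x → ℚ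
    column x = sum (summand x)
    columnSum : ∀ x → column x ≡
      t * (ind (adj p x) * F x p) + (- 1ℚ) * (ind (does (q ≟ x)) * (ind (adj p x) * F x p))
    columnSum x = begin
      column x
        ≡⟨ ∑-tabulate id (summand x) ⟨
      ∑ (allFin n) (summand x)
        ≡⟨ ∑-cong (allFin n) (λ y _ → trans
             (onEdge-ind _ x y _ (T? (adj x y)) (λ e → cong (λ r → r * F x y) (U-entry a (arc x y e))))
             (solve 4 (λ b i s f → b :* (i :* s :* f) := i :* (b :* s :* f)) refl
               (ind (adj x y)) (ind (does (p ≟ y))) (2ℚ * I₁ y - ind (does (q ≟ x))) (F x y))) ⟩
      ∑ (allFin n) (λ y → ind (does (p ≟ y)) * term x y)
        ≡⟨ ∑-ind p (term x) ⟩
      term x p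
        ≡⟨ cong (λ b → ind b * (t - ind (does (q ≟ x))) * F x p) (symm x p) ⟩
      ind (adj p x) * (t - ind (does (q ≟ x))) * F x p
        ≡⟨ solve 4 (λ b t j f → b :* (t :- j) :* f := t :* (b :* f) :+ con (- 1ℚ) :* (j :* (b :* f))) refl
             (ind (adj p x)) t (ind (does (q ≟ x))) (F x p) ⟩
      t * (ind (adj p x) * F x p) + (- 1ℚ) * (ind (does (q ≟ x)) * (ind (adj p x) * F x p)) ∎

  steps : ℕ → PairFunction → PairFunction
  steps zero    F = F
  steps (suc k) F = step (steps k F)

  -- The point mass at (w, z), so that `steps k (Δ w z)` is a column of the k-th power of U.
  Δ : Fin n → Fin n → PairFunction
  Δ w z x y = ind (does (x ≟ w)) * ind (does (y ≟ z))

  U^-entry : ∀ k a b → (U ^ k) a b ≡ steps k (Δ (origin b) (terminus b)) (origin a) (terminus a)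
  U^-entry zero    a b = δ-arc a b
  U^-entry (suc k) a b = trans (∑ₐ-cong λ c → cong (λ r → U a c * r) (U^-entry k c b)) (U-action _ a)
    where
    ∑ₐ-cong : ∀ {f g : Arc → ℚ} → (∀ c → f c ≡ g c) → ∑ₐ f ≡ ∑ₐ g
    ∑ₐ-cong {f} {g} f≗g = sum-cong-≗ λ x → sum-cong-≗ λ y → onEdge-cong x y (T? (adj x y))
      where
      onEdge-cong : ∀ x y d → onEdge f x y d ≡ onEdge g x y d
      onEdge-cong x y (yes e) = f≗g (arc x y e)
      onEdge-cong x y (no _)  = refl

  PeriodEquation : ℕ → Set
  PeriodEquation k = ∀ {w z x y} → w ~ z → x ~ y → steps k (Δ w z) x y ≡ Δ w z x y

  U^≈I⇒ : ∀ k → (U ^ k) ≈ I → PeriodEquation k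
  U^≈I⇒ k eq {w} {z} {x} {y} w~z x~y =
    trans (sym (U^-entry k (arc x y x~y) (arc w z w~z))) (trans (eq _ _) (δ-arc (arc x y x~y) (arc w z w~z)))

  ⇒U^≈I : ∀ k → PeriodEquation k → (U ^ k) ≈ I
  ⇒U^≈I k eq a b = trans (U^-entry k a b) (trans (eq (edge b) (edge a)) (sym (δ-arc a b)))

  module Isomorphic {W : Set} {H : Graph W} (iso : G ≅ H) where

    open Inverse (proj₁ iso) public using (to; from)

    to∘from : ∀ p → to (from p) ≡ p
    to∘from p = Inverse.strictlyInverseˡ (proj₁ iso) p

    from-injective : ∀ {p q} → from p ≡ from q → p ≡ q
    from-injective {p} {q} eq = trans (sym (to∘from p)) (trans (cong to eq) (to∘from q))

    preimage : ∀ w → ∃[ p ] w ≡ from p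
    preimage w = to w , sym (Inverse.strictlyInverseʳ (proj₁ iso) w)

    from-adj : ∀ p q → adj (from p) (from q) ≡ Graph.adj H p q
    from-adj p q = trans (proj₂ iso (from p) (from q)) (cong₂ (Graph.adj H) (to∘from p) (to∘from q))

    from-~ : ∀ p q → Graph.adj H p q ≡ true → T (adj (from p) (from q))
    from-~ p q eq = Equivalence.from T-≡ (trans (from-adj p q) eq)

    ~-from : ∀ p q → T (adj (from p) (from q)) → T (Graph.adj H p q)
    ~-from p q = subst T (from-adj p q)

  -- The cube of the walk and the kernel condition

  module Evolution (nbr : ∀ x → ∃[ y ] x ~ y) where

    deg≢0 : ∀ x → deg x ≢ 0
    deg≢0 x eq with nbrs x | ~⇒∈ (proj₂ (nbr x))
    deg≢0 x () | _ ∷ _ | _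

    D*I₁ : ∀ x → D x * I₁ x ≡ 1ℚ
    D*I₁ x = fromℕ*inv (deg x) (deg≢0 x)

    avg-cong : ∀ {f g} x → (∀ u → x ~ u → f u ≡ g u) → avg x f ≡ avg x g
    avg-cong x f≗g = cong (λ q → I₁ x * q) (∑-cong (nbrs x) λ u u∈ → f≗g u (∈⇒~ u∈))

    avg-const : ∀ c x → avg x (λ _ → c) ≡ c
    avg-const c x = trans (cong (λ q → I₁ x * q) (∑-const c (nbrs x)))
      (by₁ c (D*I₁ x) (solve 3 (λ i d c → i :* (d :* c) := c :+ c :* (d :* i :- con 1ℚ)) refl (I₁ x) (D x) c))

    avg-linear : ∀ a b f g x → avg x (λ u → a * f u + b * g u) ≡ a * avg x f + b * avg x g
    avg-linear a b f g x = trans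
      (cong (λ q → I₁ x * q) (trans (∑-+ _ _ (nbrs x)) (cong₂ _+_ (∑-* a f (nbrs x)) (∑-* b g (nbrs x)))))
      (solve 5 (λ i a b s t → i :* (a :* s :+ b :* t) := a :* (i :* s) :+ b :* (i :* t)) refl
        (I₁ x) a b (∑ (nbrs x) f) (∑ (nbrs x) g))

    infix 4 _≋_
    _≋_ : PairFunction → PairFunction → Set
    F ≋ H = ∀ {x y} → x ~ y → F x y ≡ H x y

    ≋-trans : ∀ {F H K} → F ≋ H → H ≋ K → F ≋ K
    ≋-trans p q e = trans (p e) (q e)

    step-cong : ∀ {F H} → F ≋ H → step F ≋ step H
    step-cong F≋H {x} e = cong₂ (λ p q → 2ℚ * p - q) (avg-cong x λ u x~u → F≋H (~-sym x~u)) (F≋H (~-sym e))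

    steps-cong : ∀ k {F H} → F ≋ H → steps k F ≋ steps k H
    steps-cong zero    p = p
    steps-cong (suc k) p = step-cong (steps-cong k p)

    -- `step ∘ flip` is the reflection 2 avg - 1 and squares to the identity, because averaging a
    -- constant returns it. With R the reversal of arcs this is U R U = R.
    step-flip-step : ∀ F → step (flip (step F)) ≋ flip F
    step-flip-step F {x} {y} _ = begin
      2ℚ * avg x (λ u → 2ℚ * N - F u x) - (2ℚ * N - F y x)
        ≡⟨ cong (λ q → 2ℚ * q - (2ℚ * N - F y x)) (trans
             (avg-cong x λ u _ → solve 2 (λ m f → con 2ℚ :* m :- f := con 2ℚ :* m :+ con (- 1ℚ) :* f) refl N (F u x))
             (trans (avg-linear 2ℚ (- 1ℚ) (λ _ → N) (λ u → F u x) x) (cong (λ q → 2ℚ * q + (- 1ℚ) * N) (avg-const N x)))) ⟩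
      2ℚ * (2ℚ * N + (- 1ℚ) * N) - (2ℚ * N - F y x)
        ≡⟨ solve 2 (λ m f → con 2ℚ :* (con 2ℚ :* m :+ con (- 1ℚ) :* m) :- (con 2ℚ :* m :- f) := f) refl N (F y x) ⟩
      F y x ∎
      where
      open ≡-Reasoning
      N = avg x (λ u → F u x)

    steps3-flip-steps3 : ∀ F → steps 3 (flip (steps 3 F)) ≋ flip F
    steps3-flip-steps3 F =
      ≋-trans {steps 3 (flip (steps 3 F))} (steps-cong 2 {step (flip (steps 3 F))} (step-flip-step (steps 2 F)))
      (≋-trans {steps 2 (flip (steps 2 F))} (steps-cong 1 {step (flip (steps 2 F))} (step-flip-step (step F))) (step-flip-step F))

    module _ (F : PairFunction) where

      -- The averages over the arcs into x and over the arcs out of x. Powers of the walk see F only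
      -- through these and one single value.
      N N′ : Fin n → ℚ
      N  x = avg x (λ u → F u x)
      N′ x = avg x (F x)

      step₂ : ∀ x y → steps 2 F x y ≡ 4ℚ * avg x N - 2ℚ * N′ x - 2ℚ * N y + F x y
      step₂ x y = begin
        2ℚ * avg x (λ u → 2ℚ * N u - F x u) - (2ℚ * N y - F x y)
          ≡⟨ cong (λ q → 2ℚ * q - (2ℚ * N y - F x y)) (trans
               (avg-cong x λ u _ → solve 2 (λ m f → con 2ℚ :* m :- f := con 2ℚ :* m :+ con (- 1ℚ) :* f) refl (N u) (F x u))
               (avg-linear 2ℚ (- 1ℚ) N (F x) x)) ⟩
        2ℚ * (2ℚ * avg x N + (- 1ℚ) * N′ x) - (2ℚ * N y - F x y)
          ≡⟨ solve 4 (λ p m k f → con 2ℚ :* (con 2ℚ :* p :+ con (- 1ℚ) :* m) :- (con 2ℚ :* k :- f) :=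
                                 con 4ℚ :* p :- con 2ℚ :* m :- con 2ℚ :* k :+ f) refl
               (avg x N) (N′ x) (N y) (F x y) ⟩
        4ℚ * avg x N - 2ℚ * N′ x - 2ℚ * N y + F x y ∎
        where open ≡-Reasoning

      step₃ : ∀ x y → steps 3 F x y ≡
        8ℚ * avg x (λ u → avg u N) - 4ℚ * avg x N′ - 4ℚ * avg y N + 2ℚ * N′ y - F y x
      step₃ x y = begin
        2ℚ * avg x (λ u → steps 2 F u x) - steps 2 F y x
          ≡⟨ cong₂ (λ p q → 2ℚ * p - q) (trans
               (avg-cong x λ u _ → trans (step₂ u x)
                 (solve 4 (λ p m k f → con 4ℚ :* p :- con 2ℚ :* m :- con 2ℚ :* k :+ f :=
                                      con 1ℚ :* (con 4ℚ :* p :+ con (- 2ℚ) :* m) :+ con 1ℚ :* (con (- 2ℚ) :* k :+ con 1ℚ :* f)) refl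
                   (avg u N) (N′ u) (N x) (F u x)))
               (trans (avg-linear 1ℚ 1ℚ _ _ x)
                 (cong₂ (λ p q → 1ℚ * p + 1ℚ * q) (avg-linear 4ℚ (- 2ℚ) (λ u → avg u N) N′ x)
                   (trans (avg-linear (- 2ℚ) 1ℚ (λ _ → N x) (λ u → F u x) x) (cong (λ q → - 2ℚ * q + 1ℚ * N x) (avg-const (N x) x))))))
               (step₂ y x) ⟩
        2ℚ * (1ℚ * (4ℚ * avg x (λ u → avg u N) + - 2ℚ * avg x N′) + 1ℚ * (- 2ℚ * N x + 1ℚ * N x))
          - (4ℚ * avg y N - 2ℚ * N′ y - 2ℚ * N x + F y x)
          ≡⟨ solve 6 (λ p q m r s f →
               con 2ℚ :* (con 1ℚ :* (con 4ℚ :* p :+ con (- 2ℚ) :* q) :+ con 1ℚ :* (con (- 2ℚ) :* m :+ con 1ℚ :* m))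
                 :- (con 4ℚ :* r :- con 2ℚ :* s :- con 2ℚ :* m :+ f) :=
               con 8ℚ :* p :- con 4ℚ :* q :- con 4ℚ :* r :+ con 2ℚ :* s :- f) refl
               (avg x (λ u → avg u N)) (avg x N′) (N x) (avg y N) (N′ y) (F y x) ⟩
        8ℚ * avg x (λ u → avg u N) - 4ℚ * avg x N′ - 4ℚ * avg y N + 2ℚ * N′ y - F y x ∎
        where open ≡-Reasoning

    -- The point mass at z relative to the degree measure.
    e : Fin n → Fin n → ℚ
    e z x = ind (does (x ≟ z)) * I₁ z

    -- An entry of A D⁻¹ A, with A the adjacency and D the degree matrix: common neighbours u count
    -- with weight 1/d_u.
    b : Fin n → Fin n → ℚ
    b x y = ∑ (nbrs x) (λ u → ind (adj y u) * I₁ u)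

    -- κ x y is the value at x of (4P² − 1) e y, where P is the averaging operator.
    κ : Fin n → Fin n → ℚ
    κ x y = 4ℚ * (I₁ x * I₁ y * b x y) - ind (does (x ≟ y)) * I₁ y

    ∑-nbrs-ind : ∀ x z (f : Fin n → ℚ) → ∑ (nbrs x) (λ u → ind (does (u ≟ z)) * f u) ≡ ind (adj x z) * f z
    ∑-nbrs-ind x z f = trans (∑-nbrs x _) (trans
      (∑-cong (allFin n) λ u _ → trans
        (cong (λ c → ind (adj x u) * (ind c * f u)) (≟-sym u z))
        (solve 3 (λ a i v → a :* (i :* v) := i :* (a :* v)) refl (ind (adj x u)) (ind (does (z ≟ u))) (f u)))
      (∑-ind z (λ u → ind (adj x u) * f u)))

    ind-~ : ∀ {x y} → x ~ y → ind (adj x y) ≡ 1ℚ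
    ind-~ x~y = cong ind (Equivalence.to T-≡ x~y)

    flip-Δ : ∀ w z x y → Δ w z y x ≡ Δ z w x y
    flip-Δ w z x y = *-comm (ind (does (y ≟ w))) (ind (does (x ≟ z)))

    N-Δ : ∀ {w z} → w ~ z → ∀ x → N (Δ w z) x ≡ e z x
    N-Δ {w} {z} w~z x with x ≟ z in eq
    ... | yes refl = trans (cong (λ q → I₁ x * q) (trans (∑-nbrs-ind x w (λ _ → 1ℚ)) (cong (λ q → q * 1ℚ) (ind-~ (~-sym w~z)))))
                       (solve 1 (λ i → i :* (con 1ℚ :* con 1ℚ) := con 1ℚ :* i) refl (I₁ x))
    ... | no _     = trans (cong (λ q → I₁ x * q) (∑-zero (nbrs x) λ u _ → *-zeroʳ (ind (does (u ≟ w)))))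
                       (trans (*-zeroʳ (I₁ x)) (sym (*-zeroˡ (I₁ z))))

    N′-Δ : ∀ {w z} → w ~ z → ∀ x → N′ (Δ w z) x ≡ e w x
    N′-Δ {w} {z} w~z x = trans (avg-cong x λ u _ → flip-Δ w z u x) (N-Δ (~-sym w~z) x)

    avg-e : ∀ z x → avg x (e z) ≡ I₁ x * (ind (adj z x) * I₁ z)
    avg-e z x = cong (λ q → I₁ x * q) (trans (∑-nbrs-ind x z (λ _ → I₁ z)) (cong (λ c → ind c * I₁ z) (symm x z)))

    avg²-e : ∀ z x → avg x (λ u → avg u (e z)) ≡ I₁ x * I₁ z * b x z
    avg²-e z x = trans (cong (λ q → I₁ x * q) (trans
        (∑-cong (nbrs x) λ u _ → trans (avg-e z u)
          (solve 3 (λ i a j → i :* (a :* j) := j :* (a :* i)) refl (I₁ u) (ind (adj z u)) (I₁ z)))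
        (∑-* (I₁ z) _ (nbrs x))))
      (sym (*-assoc (I₁ x) (I₁ z) (b x z)))

    step₂-Δ : ∀ {w z} → w ~ z → ∀ x y → steps 2 (Δ w z) x y ≡
      4ℚ * (I₁ x * (ind (adj z x) * I₁ z)) - 2ℚ * e w x - 2ℚ * e z y + Δ w z x y
    step₂-Δ {w} {z} w~z x y = trans (step₂ (Δ w z) x y)
      (cong₂ (λ p q → p - 2ℚ * q + Δ w z x y)
        (cong₂ (λ p q → 4ℚ * p - 2ℚ * q) (trans (avg-cong x λ u _ → N-Δ w~z u) (avg-e z x)) (N′-Δ w~z x))
        (N-Δ w~z y))

    step₃-Δ : ∀ {w z} → w ~ z → ∀ x y → steps 3 (Δ w z) x y ≡
      8ℚ * (I₁ x * I₁ z * b x z) - 4ℚ * avg x (e w) - 4ℚ * avg y (e z) + 2ℚ * e w y - Δ w z y x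
    step₃-Δ {w} {z} w~z x y = trans (step₃ (Δ w z) x y)
      (cong₂ (λ p q → p + 2ℚ * q - Δ w z y x)
        (cong₂ _-_
          (cong₂ (λ p q → 8ℚ * p - 4ℚ * q)
            (trans (avg-cong x λ u _ → avg-cong u λ v _ → N-Δ w~z v) (avg²-e z x))
            (avg-cong x λ u _ → N′-Δ w~z u))
          (cong (λ q → 4ℚ * q) (avg-cong y λ u _ → N-Δ w~z u)))
        (N′-Δ w~z y))

    -- In `step₃-Δ` the terms with a single average and the point mass are invariant under reversing
    -- both arcs and cancel; what remains is 4P² - 1, twice.
    steps-3-asymmetry : ∀ {w z} → w ~ z → ∀ x y →
      steps 3 (Δ w z) y x - steps 3 (Δ z w) x y ≡ 2ℚ * (κ y z - κ x w)
    steps-3-asymmetry {w} {z} w~z x y = trans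
      (cong₂ _-_ (step₃-Δ w~z y x) (step₃-Δ (~-sym w~z) x y))
      (trans (cong (λ q → 8ℚ * Y - 4ℚ * avg y (e w) - 4ℚ * avg x (e z) + 2ℚ * e w x - Δ w z x y
                    - (8ℚ * X - 4ℚ * avg x (e z) - 4ℚ * avg y (e w) + 2ℚ * e z y - q)) (flip-Δ z w x y))
        (solve 7 (λ Y X p q r s d →
           con 8ℚ :* Y :- con 4ℚ :* p :- con 4ℚ :* q :+ con 2ℚ :* r :- d
             :- (con 8ℚ :* X :- con 4ℚ :* q :- con 4ℚ :* p :+ con 2ℚ :* s :- d) :=
           con 2ℚ :* ((con 4ℚ :* Y :- s) :- (con 4ℚ :* X :- r))) refl
           Y X (avg y (e w)) (avg x (e z)) (e w x) (e z y) (Δ w z x y)))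
      where
      Y = I₁ y * I₁ z * b y z
      X = I₁ x * I₁ w * b x w

    KernelCondition : Set
    KernelCondition = ∀ {x y w z} → x ~ y → w ~ z → κ y z ≡ κ x w

    -- U³ R = U³ R U⁶ = (U³ R U³) U³ = R U³, evaluated on a point mass.
    period6⇒kernel : PeriodEquation 6 → KernelCondition
    period6⇒kernel per {x} {y} {w} {z} x~y w~z = by₁ ½ (trans (sym (steps-3-asymmetry w~z x y))
        (trans (cong (λ q → steps 3 F y x - q) commute) (+-inverseʳ (steps 3 F y x))))
        (solve 2 (λ p q → p := q :+ con ½ :* (con 2ℚ :* (p :- q) :- con 0ℚ)) refl (κ y z) (κ x w))
      where
      F = Δ w z
      commute : steps 3 (Δ z w) x y ≡ steps 3 F y x
      commute = trans (steps-cong 3 {Δ z w} {flip F} (λ {x} {y} _ → sym (flip-Δ w z x y)) x~y)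
        (trans (steps-cong 3 {flip F} {flip (steps 6 F)} (λ p → sym (per w~z (~-sym p))) x~y)
          (steps3-flip-steps3 (steps 3 F) x~y))

    -- The condition gives U³ = R U³ R, hence U⁶ = (U³ R U³) R = R R = I.
    kernel⇒period6 : KernelCondition → PeriodEquation 6
    kernel⇒period6 ker {w} {z} {x} {y} w~z x~y =
      trans (steps-cong 3 {steps 3 F} {flip (steps 3 (Δ z w))} commute x~y)
        (trans (steps3-flip-steps3 (Δ z w) x~y) (flip-Δ z w x y))
      where
      F = Δ w z
      commute : steps 3 F ≋ flip (steps 3 (Δ z w))
      commute {y} {x} y~x = by₁ 1ℚ (trans (steps-3-asymmetry w~z x y)
          (trans (cong (λ q → 2ℚ * (q - κ x w)) (ker (~-sym y~x) w~z)) (solve 1 (λ q → con 2ℚ :* (q :- q) := con 0ℚ) refl (κ x w))))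
        (solve 2 (λ p q → p := q :+ con 1ℚ :* (p :- q :- con 0ℚ)) refl (steps 3 F y x) (steps 3 (Δ z w) x y))


    -- Diagonal entries as obstructions to the periods 2 and 3

    does-refl : ∀ (v : Fin n) → does (v ≟ v) ≡ true
    does-refl v = dec-true (v ≟ v) refl

    Δ-diagonal : ∀ x y → Δ x y x y ≡ 1ℚ
    Δ-diagonal x y = cong₂ (λ p q → ind p * ind q) (does-refl x) (does-refl y)

    -- The diagonal entry of U² at (x, y) is 4/(d_x d_y) - 2/d_x - 2/d_y + 1. It is 1 only if both
    -- degrees are 1.
    period2⇒ : PeriodEquation 2 → ∀ {x y} → x ~ y → D x + D y ≡ 2ℚ
    period2⇒ per {x} {y} x~y = by₃
      (2ℚ * (D y * I₁ y) - D y) (D*I₁ x) (2ℚ - D x) (D*I₁ y) (- ½ * D x * D y) equation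
      (solve 5 (λ dx dy ix iy d → dx :+ dy := con 2ℚ :+ (con 2ℚ :* (dy :* iy) :- dy) :* (dx :* ix :- con 1ℚ)
         :+ (con 2ℚ :- dx) :* (dy :* iy :- con 1ℚ)
         :+ con (- ½) :* dx :* dy :* (con 4ℚ :* (ix :* (con 1ℚ :* iy)) :- con 2ℚ :* (con 1ℚ :* ix) :- con 2ℚ :* (con 1ℚ :* iy) :+ d :- d))
         refl (D x) (D y) (I₁ x) (I₁ y) (Δ x y x y))
      where
      entry : ℚ → ℚ → ℚ → ℚ
      entry p q r = 4ℚ * (I₁ x * (p * I₁ y)) - 2ℚ * (q * I₁ x) - 2ℚ * (r * I₁ y) + Δ x y x y
      equation : entry 1ℚ 1ℚ 1ℚ ≡ Δ x y x y
      equation = trans (sym (trans (cong (λ p → entry p (ind (does (x ≟ x))) (ind (does (y ≟ y)))) (ind-~ (~-sym x~y)))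
          (cong₂ (λ q r → entry 1ℚ (ind q) (ind r)) (does-refl x) (does-refl y))))
        (trans (sym (step₂-Δ x~y x y)) (per x~y x~y))

    -- There being no loops, all terms of the diagonal entry of U³ vanish except 8 b x y / (d_x
    -- d_y).
    period3⇒ : PeriodEquation 3 → ∀ {x y} → x ~ y → 8ℚ * b x y ≡ D x * D y
    period3⇒ per {x} {y} x~y = by₃
      (- (8ℚ * b x y * (D y * I₁ y))) (D*I₁ x) (- (8ℚ * b x y)) (D*I₁ y) (D x * D y) equation
      (solve 5 (λ dx dy ix iy s → con 8ℚ :* s := dx :* dy :+ (:- (con 8ℚ :* s :* (dy :* iy))) :* (dx :* ix :- con 1ℚ)
         :+ (:- (con 8ℚ :* s)) :* (dy :* iy :- con 1ℚ)
         :+ dx :* dy :* (con 8ℚ :* (ix :* iy :* s) :- con 4ℚ :* (ix :* (con 0ℚ :* ix)) :- con 4ℚ :* (iy :* (con 0ℚ :* iy))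
              :+ con 2ℚ :* (con 0ℚ :* ix) :- con 0ℚ :* con 0ℚ :- con 1ℚ))
         refl (D x) (D y) (I₁ x) (I₁ y) (b x y))
      where
      entry : ℚ → ℚ → ℚ → ℚ → ℚ
      entry p q r s = 8ℚ * (I₁ x * I₁ y * b x y) - 4ℚ * p - 4ℚ * q + 2ℚ * (r * I₁ x) - r * s
      does-≢ : ∀ {u v : Fin n} → u ≢ v → ind (does (u ≟ v)) ≡ 0ℚ
      does-≢ {u} {v} u≢v = cong ind (dec-false (u ≟ v) u≢v)
      avg-e-self : ∀ v → avg v (e v) ≡ I₁ v * (0ℚ * I₁ v)
      avg-e-self v = trans (avg-e v v) (cong (λ c → I₁ v * (ind c * I₁ v)) (irrefl v))
      equation : entry (I₁ x * (0ℚ * I₁ x)) (I₁ y * (0ℚ * I₁ y)) 0ℚ 0ℚ ≡ 1ℚ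
      equation = trans (sym (trans
          (cong₂ (λ p q → entry p q (ind (does (y ≟ x))) (ind (does (x ≟ y)))) (avg-e-self x) (avg-e-self y))
          (cong₂ (λ r s → entry (I₁ x * (0ℚ * I₁ x)) (I₁ y * (0ℚ * I₁ y)) r s)
            (does-≢ (~-irrefl (~-sym x~y))) (does-≢ (~-irrefl x~y)))))
        (trans (sym (step₃-Δ x~y x y)) (trans (per x~y x~y) (Δ-diagonal x y)))

    nbrs-↭ : ∀ {x ys} → Unique ys → (∀ {u} → x ~ u → u ∈ ys) → (∀ {u} → u ∈ ys → x ~ u) → nbrs x ↭ ys
    nbrs-↭ {x} ys! to from = ∼bag⇒↭ (unique∧set⇒bag (nbrs-unique x) ys! (mk⇔ (to ∘ ∈⇒~) (~⇒∈ ∘ from)))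

    -- Windmills and theta graphs described by neighbour lists

    -- One permutation records the degree 2, the two neighbours and their distinctness.
    Pair : Fin n → Fin n → Fin n → Set
    Pair x p q = nbrs x ↭ p ∷ q ∷ []

    module _ {x p q} (P : Pair x p q) where

      pair-~ : ∀ {u} → x ~ u → u ≡ p ⊎ u ≡ q
      pair-~ x~u with ∈-resp-↭ P (~⇒∈ x~u)
      ... | here u≡p         = inj₁ u≡p
      ... | there (here u≡q) = inj₂ u≡q

      pair-~₁ : x ~ p
      pair-~₁ = ∈⇒~ (∈-resp-↭ (↭-sym P) (here refl))

      pair-~₂ : x ~ q
      pair-~₂ = ∈⇒~ (∈-resp-↭ (↭-sym P) (there (here refl)))

      pair-≢ : p ≢ q
      pair-≢ with Permutationₛ.Unique-resp-↭ (setoid (Fin n)) (↭⇒↭ₛ P) (nbrs-unique x)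
      ... | (p≢q ∷ []) ∷ _ = p≢q

      pair-deg : deg x ≡ 2
      pair-deg = ↭-length P

      pair-I₁ : I₁ x ≡ ½
      pair-I₁ = cong inv pair-deg

      pair-D : D x ≡ 2ℚ
      pair-D = cong fromℕ pair-deg

      pair-b : ∀ y → b x y ≡ ind (adj y p) * I₁ p + ind (adj y q) * I₁ q
      pair-b y = trans (∑-↭ _ P) (cong (λ r → ind (adj y p) * I₁ p + r) (+-identityʳ _))

      pair-swap : Pair x q p
      pair-swap = ↭-trans P (swap p q ↭-refl)

    pairWith : ∀ {x p} → deg x ≡ 2 → x ~ p → ∃[ q ] Pair x p q
    pairWith {x} deg≡2 x~p with nbrs x | ~⇒∈ x~p
    ... | _ ∷ q ∷ [] | here refl         = q , ↭-refl
    ... | q ∷ _ ∷ [] | there (here refl) = q , swap q _ ↭-refl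

    ind-≁ : ∀ {x y} → ¬ x ~ y → ind (adj x y) ≡ 0ℚ
    ind-≁ {x} {y} x≁y with adj x y
    ... | true  = ⊥-elim (x≁y _)
    ... | false = refl

    b-sym : ∀ x y → b x y ≡ b y x
    b-sym x y = trans (∑-nbrs x _) (trans
      (∑-cong (allFin n) λ u _ → solve 3 (λ p q i → p :* (q :* i) := q :* (p :* i)) refl (ind (adj x u)) (ind (adj y u)) (I₁ u))
      (sym (∑-nbrs y _)))

    b-self : ∀ x → b x x ≡ ∑ (nbrs x) I₁
    b-self x = ∑-cong (nbrs x) λ u u∈ → trans (cong (λ q → q * I₁ u) (ind-~ (∈⇒~ u∈))) (*-identityˡ (I₁ u))

    κ-sym : ∀ x y → κ x y ≡ κ y x
    κ-sym x y with x ≟ y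
    ... | yes refl rewrite does-refl x = refl
    ... | no x≢y   rewrite dec-false (y ≟ x) (x≢y ∘ sym) = cong₂ (λ p q → 4ℚ * p - q)
      (trans (cong (λ q → I₁ x * I₁ y * q) (b-sym x y)) (cong (λ q → q * b y x) (*-comm (I₁ x) (I₁ y))))
      (trans (*-zeroˡ (I₁ y)) (sym (*-zeroˡ (I₁ x))))

    κ-≢ : ∀ {x y} → x ≢ y → κ x y ≡ 4ℚ * (I₁ x * I₁ y * b x y)
    κ-≢ {x} {y} x≢y rewrite dec-false (x ≟ y) x≢y =
      solve 2 (λ p i → p :- con 0ℚ :* i := p) refl (4ℚ * (I₁ x * I₁ y * b x y)) (I₁ y)

    κ-self : ∀ x → κ x x ≡ 4ℚ * (I₁ x * I₁ x * b x x) - I₁ x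
    κ-self x rewrite does-refl x = cong (λ q → 4ℚ * (I₁ x * I₁ x * b x x) - q) (*-identityˡ (I₁ x))

    0<I₁ : ∀ x → 0ℚ < I₁ x
    0<I₁ x = 0<inv (deg≢0 x)

    0<D : ∀ x → 0ℚ < D x
    0<D x with deg x | deg≢0 x
    ... | zero  | 0≢0 = contradiction refl 0≢0
    ... | suc k | _   = 0<fromℕ k

    I₁≤b : ∀ {x y u} → x ~ u → y ~ u → I₁ u ≤ b x y
    I₁≤b {x} {y} {u} x~u y~u = subst (λ q → q ≤ b x y) (trans (cong (λ q → q * I₁ u) (ind-~ y~u)) (*-identityˡ (I₁ u)))
      (∈⇒≤∑ (λ v → 0≤* (0≤ind (adj y v)) (0≤inv (deg v))) (~⇒∈ x~u))

    -- From this it follows that mates come in pairs and that h is adjacent to every other vertex.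
    record IsWindmill (h : Fin n) : Set where
      field
        mate : ∀ {w} → w ≢ h → ∃[ s ] Pair w h s

    -- `balanced` makes the constants 1/d_r and 1/d_l, which κ takes within the two colour classes,
    -- agree.
    record IsTheta (l r : Fin n) : Set where
      field
        l≢r      : l ≢ r
        l≁r      : ¬ l ~ r
        cover    : ∀ w → w ≡ l ⊎ w ≡ r ⊎ l ~ w ⊎ r ~ w
        disjoint : ∀ {w} → l ~ w → ¬ r ~ w
        mateˡ    : ∀ {w} → l ~ w → ∃[ s ] Pair w l s × r ~ s
        mateʳ    : ∀ {w} → r ~ w → ∃[ s ] Pair w r s × l ~ s
        balanced : I₁ l ≡ I₁ r

    -- `deg h ≢ 2` keeps out the triangle, a windmill with one blade, which has period 3.
    data Shape : Set where
      windmill : ∀ h → IsWindmill h → deg h ≢ 2 → Shape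
      theta    : ∀ l r → IsTheta l r → Shape

    b-between : ∀ {x p q} → Pair x p q → ∀ {y α β} → ind (adj y p) ≡ α → ind (adj y q) ≡ β → b x y ≡ α * I₁ p + β * I₁ q
    b-between {p = p} {q} P {y} α-eq β-eq = trans (pair-b P y) (cong₂ (λ α β → α * I₁ p + β * I₁ q) α-eq β-eq)

    -- Here b h h = d_h / 2, and 4/d_h² · d_h/2 - 1/d_h = 1/d_h.
    κ-centre : ∀ {h} → (∀ {u} → h ~ u → I₁ u ≡ ½) → κ h h ≡ I₁ h
    κ-centre {h} half = trans (κ-self h) (trans (cong (λ s → 4ℚ * (I₁ h * I₁ h * s) - I₁ h) bhh)
      (by₁ (2ℚ * I₁ h) (D*I₁ h) (solve 2 (λ i d → con 4ℚ :* (i :* i :* (d :* con ½)) :- i := i :+ con 2ℚ :* i :* (d :* i :- con 1ℚ)) refl (I₁ h) (D h))))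
      where
      bhh : b h h ≡ D h * ½
      bhh = trans (b-self h) (trans (∑-cong (nbrs h) λ u u∈ → half (∈⇒~ u∈)) (∑-const ½ (nbrs h)))

    κ-evaluate : ∀ {x y β} → x ≢ y → I₁ x ≡ ½ → b x y ≡ β → κ x y ≡ 2ℚ * (I₁ y * β)
    κ-evaluate {x} {y} {β} x≢y I₁x b-eq = trans (κ-≢ x≢y) (trans (cong₂ (λ i s → 4ℚ * (i * I₁ y * s)) I₁x b-eq)
      (solve 2 (λ i s → con 4ℚ :* (con ½ :* i :* s) := con 2ℚ :* (i :* s)) refl (I₁ y) β))

    κ-pair-self : ∀ {x p q} → Pair x p q → I₁ q ≡ ½ → κ x x ≡ I₁ p
    κ-pair-self {x} {p} {q} P I₁q = trans (κ-self x) (trans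
      (cong₂ (λ i s → 4ℚ * (i * i * s) - i) (pair-I₁ P)
        (trans (b-between P (ind-~ (pair-~₁ P)) (ind-~ (pair-~₂ P))) (cong (λ i → 1ℚ * I₁ p + 1ℚ * i) I₁q)))
      (solve 1 (λ i → con 4ℚ :* (con ½ :* con ½ :* (con 1ℚ :* i :+ con 1ℚ :* con ½)) :- con ½ := i) refl (I₁ p)))

    pair-edge⇒¬period2 : ∀ {x y p q} → Pair x p y → Pair y q x → ¬ PeriodEquation 2
    pair-edge⇒¬period2 P Q per = contradiction (trans (sym (cong₂ _+_ (pair-D P) (pair-D Q))) (period2⇒ per (pair-~₂ P))) λ ()

    -- The only possible common neighbour of x and y is p, so this is `period3⇒` with both degrees
    -- equal to 2.
    pair-edge-period3 : ∀ {x y p q} → Pair x p y → Pair y q x → PeriodEquation 3 → 8ℚ * (ind (adj y p) * I₁ p) ≡ 4ℚ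
    pair-edge-period3 {x} {y} {p} P Q per = trans (cong (λ s → 8ℚ * s)
        (sym (trans (b-between P refl (cong ind (irrefl y)))
          (solve 2 (λ s i → s :+ con 0ℚ :* i := s) refl (ind (adj y p) * I₁ p) (I₁ y)))))
      (trans (period3⇒ per (pair-~₂ P)) (cong₂ _*_ (pair-D P) (pair-D Q)))

    module Windmill {h} (W : IsWindmill h) where
      open IsWindmill W

      rim-half : ∀ {w} → w ≢ h → I₁ w ≡ ½
      rim-half w≢h = pair-I₁ (proj₂ (mate w≢h))

      mate-pair : ∀ {x s} → x ≢ h → Pair x h s → Pair s h x
      mate-pair x≢h P with mate (pair-≢ P ∘ sym)
      ... | t , Q with pair-~ Q (~-sym (pair-~₂ P))
      ...   | inj₁ refl = contradiction refl x≢h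
      ...   | inj₂ refl = Q

      -- Off the diagonal there is exactly one common neighbour: s with weight 1/2 if y = h, and h
      -- itself if y lies on the rim. Dividing by the degrees gives 1/d_h both times.
      κ-rim : ∀ {x} → x ≢ h → ∀ y → κ x y ≡ I₁ h
      κ-rim {x} x≢h y with mate x≢h
      ... | s , P = cases (y ≟ x) (y ≟ h)
        where
        Q : Pair s h x
        Q = mate-pair x≢h P
        I₁s : I₁ s ≡ ½
        I₁s = pair-I₁ Q
        cases : Dec (y ≡ x) → Dec (y ≡ h) → κ x y ≡ I₁ h
        cases (yes refl) _ = κ-pair-self P I₁s
        cases (no y≢x) (yes refl) = trans (κ-evaluate x≢h (pair-I₁ P)
            (trans (b-between P (cong ind (irrefl h)) (ind-~ (~-sym (pair-~₁ Q)))) (cong (λ i → 0ℚ * I₁ h + 1ℚ * i) I₁s)))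
          (solve 1 (λ i → con 2ℚ :* (i :* (con 0ℚ :* i :+ con 1ℚ :* con ½)) := i) refl (I₁ h))
        cases (no y≢x) (no y≢h) = trans (κ-evaluate (y≢x ∘ sym) (pair-I₁ P)
            (b-between P (ind-~ (pair-~₁ (proj₂ (mate y≢h)))) (ind-≁ y≁s)))
          (trans (cong (λ i → 2ℚ * (i * (1ℚ * I₁ h + 0ℚ * I₁ s))) (rim-half y≢h))
            (solve 2 (λ i j → con 2ℚ :* (con ½ :* (con 1ℚ :* i :+ con 0ℚ :* j)) := i) refl (I₁ h) (I₁ s)))
          where
          y≁s : ¬ y ~ s
          y≁s y~s with pair-~ Q (~-sym y~s)
          ... | inj₁ y≡h = y≢h y≡h
          ... | inj₂ y≡x = y≢x y≡x

      κ≡I₁h : ∀ x y → κ x y ≡ I₁ h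
      κ≡I₁h x y with x ≟ h | y ≟ h
      ... | no x≢h   | _        = κ-rim x≢h y
      ... | yes refl | no y≢h   = trans (κ-sym h y) (κ-rim y≢h h)
      ... | yes refl | yes refl = κ-centre λ h~u → rim-half (~-irrefl h~u ∘ sym)

      kernel : KernelCondition
      kernel {x} {y} {w} {z} _ _ = trans (κ≡I₁h y z) (sym (κ≡I₁h x w))

      blade : ∃[ w ] ∃[ s ] Pair w h s × Pair s h w
      blade with nbr h
      ... | w , h~w with mate (~-irrefl h~w ∘ sym)
      ...   | s , P = w , s , P , mate-pair (~-irrefl h~w ∘ sym) P

      ¬period2 : ¬ PeriodEquation 2
      ¬period2 with blade
      ... | _ , _ , P , Q = pair-edge⇒¬period2 P Q

      -- The two rim vertices of a blade have the hub as common neighbour, so period 3 would mean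
      -- 8/d_h = 4.
      ¬period3 : deg h ≢ 2 → ¬ PeriodEquation 3
      ¬period3 deg≢2 per with blade
      ... | w , s , P , Q = deg≢2 (fromℕ≡2⇒≡2 (deg h) (by₂ (- (+ 1 / 4) * D h)
          (trans (cong (λ p → 8ℚ * (p * I₁ h)) (sym (ind-~ (pair-~₁ Q)))) (pair-edge-period3 P Q per))
          2ℚ (D*I₁ h)
          (solve 2 (λ d i → d := con 2ℚ :+ con (- (+ 1 / 4)) :* d :* (con 8ℚ :* (con 1ℚ :* i) :- con 4ℚ) :+ con 2ℚ :* (d :* i :- con 1ℚ))
            refl (D h) (I₁ h))))

    -- Values of κ at the neighbours of r; `theta-swap` turns them into those at the neighbours of
    -- l.
    module Near {l r} (Θ : IsTheta l r) where
      open IsTheta Θ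

      mate-pair : ∀ {x s} → r ~ x → Pair x r s → Pair s l x
      mate-pair r~x P with mateʳ r~x
      ... | s′ , P′ , l~s′ with pair-~ P (pair-~₂ P′)
      ...   | inj₁ refl = contradiction l~s′ (l≁r)
      ...   | inj₂ refl with mateˡ l~s′
      ...     | t , Q , r~t with pair-~ Q (~-sym (pair-~₂ P))
      ...       | inj₁ refl = contradiction (~-sym r~x) l≁r
      ...       | inj₂ refl = Q

      near-half : ∀ {x} → r ~ x → I₁ x ≡ ½
      near-half r~x = pair-I₁ (proj₁ (proj₂ (mateʳ r~x)))

      module _ {x} (r~x : r ~ x) where

        private
          s = proj₁ (mateʳ r~x)
          P : Pair x r s
          P = proj₁ (proj₂ (mateʳ r~x))
          l~s : l ~ s
          l~s = proj₂ (proj₂ (mateʳ r~x))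
          Q : Pair s l x
          Q = mate-pair r~x P

        κ-near-near : ∀ {y} → r ~ y → κ x y ≡ I₁ r
        κ-near-near {y} r~y with y ≟ x
        ... | yes refl = κ-pair-self P (pair-I₁ Q)
        ... | no y≢x   = trans (κ-evaluate (y≢x ∘ sym) (pair-I₁ P) (b-between P (ind-~ (~-sym r~y)) (ind-≁ y≁s)))
            (trans (cong (λ i → 2ℚ * (i * (1ℚ * I₁ r + 0ℚ * I₁ s))) (near-half r~y))
              (solve 2 (λ i j → con 2ℚ :* (con ½ :* (con 1ℚ :* i :+ con 0ℚ :* j)) := i) refl (I₁ r) (I₁ s)))
          where
          y≁s : ¬ y ~ s
          y≁s y~s with pair-~ Q (~-sym y~s)
          ... | inj₁ refl = l≁r (~-sym r~y)
          ... | inj₂ y≡x  = y≢x y≡x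

        -- The common neighbour is the mate s of x, of weight 1/2: the value is 1/d_l, and this is
        -- 1/d_r by `balanced`.
        κ-near-far : κ x l ≡ I₁ r
        κ-near-far = trans (κ-evaluate x≢l (pair-I₁ P)
            (trans (b-between P (ind-≁ l≁r) (ind-~ l~s)) (cong (λ i → 0ℚ * I₁ r + 1ℚ * i) (pair-I₁ Q))))
          (trans (solve 2 (λ i j → con 2ℚ :* (i :* (con 0ℚ :* j :+ con 1ℚ :* con ½)) := i) refl (I₁ l) (I₁ r)) balanced)
          where
          x≢l : x ≢ l
          x≢l refl = l≁r (~-sym r~x)

        κ-zero : ∀ {y} → x ≢ y → ¬ y ~ r → ¬ y ~ s → κ x y ≡ 0ℚ
        κ-zero {y} x≢y y≁r y≁s = trans (κ-evaluate x≢y (pair-I₁ P) (b-between P (ind-≁ y≁r) (ind-≁ y≁s)))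
          (solve 3 (λ i j k → con 2ℚ :* (i :* (con 0ℚ :* j :+ con 0ℚ :* k)) := con 0ℚ) refl (I₁ y) (I₁ r) (I₁ s))

        κ-near-centre : κ x r ≡ 0ℚ
        κ-near-centre = κ-zero (~-irrefl r~x ∘ sym) (λ r~r → ~-irrefl r~r refl) (disjoint l~s)

        κ-near-other : ∀ {y} → l ~ y → κ x y ≡ 0ℚ
        κ-near-other {y} l~y = κ-zero (λ { refl → disjoint l~y r~x }) (disjoint l~y ∘ ~-sym) y≁s
          where
          y≁s : ¬ y ~ s
          y≁s y~s with pair-~ Q (~-sym y~s)
          ... | inj₁ refl = ~-irrefl l~y refl
          ... | inj₂ refl = disjoint l~y r~x

    theta-swap : ∀ {l r} → IsTheta l r → IsTheta r l
    theta-swap Θ = record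
      { l≢r      = l≢r ∘ sym
      ; l≁r      = l≁r ∘ ~-sym
      ; cover    = λ w → exchange (cover w)
      ; disjoint = λ r~w l~w → disjoint l~w r~w
      ; mateˡ    = mateʳ
      ; mateʳ    = mateˡ
      ; balanced = sym balanced
      }
      where
      open IsTheta Θ
      exchange : ∀ {A B C E : Set} → A ⊎ B ⊎ C ⊎ E → B ⊎ A ⊎ E ⊎ C
      exchange (inj₁ p)               = inj₂ (inj₁ p)
      exchange (inj₂ (inj₁ p))        = inj₁ p
      exchange (inj₂ (inj₂ (inj₁ p))) = inj₂ (inj₂ (inj₂ p))
      exchange (inj₂ (inj₂ (inj₂ p))) = inj₂ (inj₂ (inj₁ p))

    module Side {l r} (Θ : IsTheta l r) where
      open IsTheta Θ
      open Near Θ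
      module Swapped = Near (theta-swap Θ)

      -- The colour class of l in the bipartition.
      Left : Fin n → Set
      Left x = x ≡ l ⊎ r ~ x

      Right : Fin n → Set
      Right x = x ≡ r ⊎ l ~ x

      left-neighbour : ∀ {x y} → Left x → x ~ y → Right y
      left-neighbour (inj₁ refl) l~y = inj₂ l~y
      left-neighbour (inj₂ r~x) x~y with mateʳ r~x
      ... | s , P , l~s with pair-~ P x~y
      ...   | inj₁ y≡r  = inj₁ y≡r
      ...   | inj₂ refl = inj₂ l~s

      left-or-right : ∀ x → Left x ⊎ Right x
      left-or-right x with cover x
      ... | inj₁ p               = inj₁ (inj₁ p)
      ... | inj₂ (inj₁ p)        = inj₂ (inj₁ p)
      ... | inj₂ (inj₂ (inj₁ p)) = inj₂ (inj₂ p)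
      ... | inj₂ (inj₂ (inj₂ p)) = inj₁ (inj₂ p)

      κ-left-left : ∀ {x y} → Left x → Left y → κ x y ≡ I₁ r
      κ-left-left (inj₁ refl) (inj₁ refl) = trans (κ-centre Swapped.near-half) balanced
      κ-left-left (inj₁ refl) (inj₂ r~y)  = trans (κ-sym l _) (κ-near-far r~y)
      κ-left-left (inj₂ r~x)  (inj₁ refl) = κ-near-far r~x
      κ-left-left (inj₂ r~x)  (inj₂ r~y)  = κ-near-near r~x r~y

      κ-left-right : ∀ {x y} → Left x → Right y → κ x y ≡ 0ℚ
      κ-left-right (inj₁ refl) (inj₁ refl) = trans (κ-≢ l≢r) (trans
        (cong (λ s → 4ℚ * (I₁ l * I₁ r * s)) (∑-zero (nbrs l) λ u u∈ →
          trans (cong (λ p → p * I₁ u) (ind-≁ (disjoint (∈⇒~ u∈)))) (*-zeroˡ (I₁ u))))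
        (solve 2 (λ i j → con 4ℚ :* (i :* j :* con 0ℚ) := con 0ℚ) refl (I₁ l) (I₁ r)))
      κ-left-right (inj₁ refl) (inj₂ l~y)  = trans (κ-sym l _) (Swapped.κ-near-centre l~y)
      κ-left-right (inj₂ r~x)  (inj₁ refl) = κ-near-centre r~x
      κ-left-right (inj₂ r~x)  (inj₂ l~y)  = κ-near-other r~x l~y

    module Theta {l r} (Θ : IsTheta l r) where
      open IsTheta Θ
      open Side Θ
      module Other = Side (theta-swap Θ)

      -- Every edge changes the colour class, so y and z are in the same class exactly if x and w
      -- are.
      kernel : KernelCondition
      kernel {x} {y} {w} {z} x~y w~z with left-or-right x | left-or-right w
      ... | inj₁ Lx | inj₁ Lw = trans (Other.κ-left-left (left-neighbour Lx x~y) (left-neighbour Lw w~z))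
                                  (trans balanced (sym (κ-left-left Lx Lw)))
      ... | inj₁ Lx | inj₂ Rw = trans (Other.κ-left-right (left-neighbour Lx x~y) (Other.left-neighbour Rw w~z))
                                  (sym (κ-left-right Lx Rw))
      ... | inj₂ Rx | inj₁ Lw = trans (κ-left-right (Other.left-neighbour Rx x~y) (left-neighbour Lw w~z))
                                  (sym (Other.κ-left-right Rx Lw))
      ... | inj₂ Rx | inj₂ Rw = trans (κ-left-left (Other.left-neighbour Rx x~y) (Other.left-neighbour Rw w~z))
                                  (trans (sym balanced) (sym (Other.κ-left-left Rx Rw)))

      rung : ∃[ w ] ∃[ s ] Pair w r s × Pair s l w × l ~ s
      rung with nbr r
      ... | w , r~w with mateʳ r~w
      ...   | s , P , l~s = w , s , P , Near.mate-pair Θ r~w P , l~s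

      ¬period2 : ¬ PeriodEquation 2
      ¬period2 with rung
      ... | _ , _ , P , Q , _ = pair-edge⇒¬period2 P Q

      -- The two inner vertices of a path have no common neighbour, so period 3 would mean 0 = 4.
      ¬period3 : ¬ PeriodEquation 3
      ¬period3 per with rung
      ... | w , s , P , Q , l~s = contradiction
        (trans (sym (trans (cong (λ p → 8ℚ * (p * I₁ r)) (ind-≁ (disjoint l~s ∘ ~-sym)))
          (solve 1 (λ i → con 8ℚ :* (con 0ℚ :* i) := con 0ℚ) refl (I₁ r)))) (pair-edge-period3 P Q per)) λ ()

    -- The minimal period divides 6, so it suffices to exclude its maximal proper divisors.
    period6-minimal : KernelCondition → ¬ PeriodEquation 2 → ¬ PeriodEquation 3 → Periodic G 6
    period6-minimal ker ¬2 ¬3 = ℕ.z<s , ⇒U^≈I 6 per6 , λ k 0<k eq → minimal k 0<k (U^≈I⇒ k eq)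
      where
      per6 : PeriodEquation 6
      per6 = kernel⇒period6 ker
      minimal : ∀ k → 0 ℕ.< k → PeriodEquation k → 6 ℕ.≤ k
      minimal 1 _ per = ⊥-elim (¬2 λ {w} {z} w~z x~y →
        trans (step-cong {step (Δ w z)} {Δ w z} (per w~z) x~y) (per w~z x~y))
      minimal 2 _ per = ⊥-elim (¬2 per)
      minimal 3 _ per = ⊥-elim (¬3 per)
      minimal 4 _ per = ⊥-elim (¬2 λ {w} {z} w~z x~y →
        trans (sym (steps-cong 2 {steps 4 (Δ w z)} {Δ w z} (per w~z) x~y)) (per6 w~z x~y))
      minimal 5 _ per = ⊥-elim (¬2 λ {w} {z} w~z x~y →
        trans (step-cong {step (Δ w z)} {Δ w z} (one w~z) x~y) (one w~z x~y))
        where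
        one : PeriodEquation 1
        one {w} {z} w~z x~y = trans (sym (step-cong {steps 5 (Δ w z)} {Δ w z} (per w~z) x~y)) (per6 w~z x~y)
      minimal (suc (suc (suc (suc (suc (suc k)))))) _ _ =
        ℕ.s≤s (ℕ.s≤s (ℕ.s≤s (ℕ.s≤s (ℕ.s≤s (ℕ.s≤s ℕ.z≤n)))))

    -- Isomorphisms from the local descriptions

    module _ {h} (W : IsWindmill h) where

      open IsWindmill W

      private
        rim? : ∀ w → Dec (w ≢ h)
        rim? w = ¬? (w ≟ h)
        partner = choose {Q = λ w s → Pair w h s} rim? mate
        σ = proj₁ partner
        σ-pair : ∀ {w} → w ≢ h → Pair w h (σ w)
        σ-pair = proj₂ partner
        -- Each pair of mates is represented by the one with the smaller index.
        Rep : Fin n → Set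
        Rep w = w ≢ h × toℕ w ℕ.< toℕ (σ w)
        Rep? : ∀ w → Dec (Rep w)
        Rep? w = rim? w ×-dec (toℕ w ℕ.<? toℕ (σ w))
        list = filter Rep? (allFin n)
        ∈⇒Rep : ∀ {w} → w ∈ list → Rep w
        ∈⇒Rep w∈ = proj₂ (∈-filter⁻ Rep? {xs = allFin n} w∈)
        Rep⇒∈ : ∀ {w} → Rep w → w ∈ list
        Rep⇒∈ {w} = ∈-filter⁺ Rep? (∈-allFin w)
        σ-rim : ∀ {w} → w ≢ h → σ w ≢ h
        σ-rim w≢h = pair-≢ (σ-pair w≢h) ∘ sym
        only : ∀ {w u} → w ≢ h → u ≢ h → w ~ u → u ≡ σ w
        only w≢h u≢h w~u with pair-~ (σ-pair w≢h) w~u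
        ... | inj₁ u≡h = contradiction u≡h u≢h
        ... | inj₂ u≡σ = u≡σ
        σσ : ∀ {w} → w ≢ h → σ (σ w) ≡ w
        σσ w≢h = sym (only (σ-rim w≢h) w≢h (~-sym (pair-~₂ (σ-pair w≢h))))

      rimMatching : Matching G (_≢ h)
      rimMatching = record
        { reps      = list
        ; unique    = Unique.filter⁺ Rep? (Unique.allFin⁺ n)
        ; σ         = σ
        ; σ-edge    = pair-~₂ ∘ σ-pair
        ; σ-ord     = σ-rim
        ; σ-only    = only
        ; reps-ord  = proj₁ ∘ ∈⇒Rep
        ; split     = split
        ; exclusive = λ {w} w∈ σw∈ → let (w≢h , w<σw) = ∈⇒Rep w∈ in
            ℕ.<-asym w<σw (subst (λ u → toℕ (σ w) ℕ.< toℕ u) (σσ w≢h) (proj₂ (∈⇒Rep σw∈)))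
        }
        where
        split : ∀ {w} → w ≢ h → w ∈ list ⊎ σ w ∈ list
        split {w} w≢h with ℕ.<-cmp (toℕ w) (toℕ (σ w))
        ... | tri< w<σw _ _ = inj₁ (Rep⇒∈ (w≢h , w<σw))
        ... | tri≈ _ w≡σw _ = contradiction (toℕ-injective w≡σw) (~-irrefl (pair-~₂ (σ-pair w≢h)))
        ... | tri> _ _ w>σw = inj₂ (Rep⇒∈ (σ-rim w≢h , subst (λ u → toℕ (σ w) ℕ.< toℕ u) (sym (σσ w≢h)) w>σw))

      open Matching rimMatching using (t; slot; slot-ord; slot-injective; slot-surjective; slot-adj)

      hub-edge : ∀ {w} → w ≢ h → h ~ w
      hub-edge w≢h = ~-sym (pair-~₁ (σ-pair w≢h))

      windmill-≅ : G ≅ DutchWindmill t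
      windmill-≅ = ≅-from G (DutchWindmill t) from injective surjective adj-eq
        where
        from : WindmillVertex t → Fin n
        from hub       = h
        from (rim i a) = slot i a
        injective : ∀ {p q} → from p ≡ from q → p ≡ q
        injective {hub}     {hub}     eq = refl
        injective {hub}     {rim j b} eq = contradiction (sym eq) (slot-ord j b)
        injective {rim i a} {hub}     eq = contradiction eq (slot-ord i a)
        injective {rim i a} {rim j b} eq with slot-injective i a j b eq
        ... | refl , refl = refl
        surjective : ∀ v → ∃[ p ] from p ≡ v
        surjective v with v ≟ h
        ... | yes refl = hub , refl
        ... | no v≢h with slot-surjective v≢h
        ...   | i , a , eq = rim i a , eq
        adj-eq : ∀ p q → adj (from p) (from q) ≡ windmillAdj p q
        adj-eq hub       hub       = irrefl h
        adj-eq hub       (rim j b) = ≡true (hub-edge (slot-ord j b))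
        adj-eq (rim i a) hub       = ≡true (~-sym (hub-edge (slot-ord i a)))
        adj-eq (rim i a) (rim j b) = slot-adj i a j b

      -- The hub has a neighbour, so there is a blade; if it were the only one, its two slots would
      -- be all neighbours of h.
      two-blades : deg h ≢ 2 → t ℕ.≥ 2
      two-blades deg≢2 = bound t refl
        where
        Fin-one : ∀ {m} → m ≡ 1 → (i j : Fin m) → i ≡ j
        Fin-one refl zero zero = refl
        Fin-none : ∀ {m} → m ≡ 0 → ¬ Fin m
        Fin-none refl ()
        blade : Fin t
        blade = proj₁ (slot-surjective (~-irrefl (proj₂ (nbr h)) ∘ sym))
        bound : ∀ m → t ≡ m → m ℕ.≥ 2
        bound zero          eq = contradiction blade (Fin-none eq)
        bound (suc (suc m)) eq = ℕ.s≤s (ℕ.s≤s ℕ.z≤n)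
        bound (suc zero)    eq = contradiction (↭-length (nbrs-↭ distinct to from)) deg≢2
          where
          pair = slot blade zero ∷ slot blade (suc zero) ∷ []
          distinct : Unique pair
          distinct = ((λ p → contradiction (proj₂ (slot-injective blade zero blade (suc zero) p)) λ ()) ∷ []) ∷ [] ∷ []
          to : ∀ {u} → h ~ u → u ∈ pair
          to h~u with slot-surjective (~-irrefl h~u ∘ sym)
          ... | i , a , refl with Fin-one eq i blade
          to h~u | i , zero , refl     | refl = here refl
          to h~u | i , suc zero , refl | refl = there (here refl)
          from : ∀ {u} → u ∈ pair → h ~ u
          from (here refl)         = hub-edge (slot-ord blade zero)
          from (there (here refl)) = hub-edge (slot-ord blade (suc zero))

      isWindmill⇒≅ : deg h ≢ 2 → ∃[ t ] (t ≥ 2 × G ≅ DutchWindmill t)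
      isWindmill⇒≅ deg≢2 = t , two-blades deg≢2 , windmill-≅

    module _ {l r} (Θ : IsTheta l r) where

      open IsTheta Θ

      private
        Inner : Fin n → Set
        Inner w = l ~ w ⊎ r ~ w
        -- Everything needed about a mate in one relation, as `choose` retains nothing else of how
        -- it was picked.
        Crossing : Fin n → Fin n → Set
        Crossing w s = w ~ s × (∀ {u} → Inner u → w ~ u → u ≡ s) × (l ~ w × r ~ s ⊎ r ~ w × l ~ s)
        not-l : ¬ Inner l
        not-l (inj₁ l~l) = ~-irrefl l~l refl
        not-l (inj₂ r~l) = l≁r (~-sym r~l)
        not-r : ¬ Inner r
        not-r (inj₁ l~r) = l≁r l~r
        not-r (inj₂ r~r) = ~-irrefl r~r refl
        only : ∀ {w p s} → ¬ Inner p → Pair w p s → ∀ {u} → Inner u → w ~ u → u ≡ s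
        only ¬p P o w~u with pair-~ P w~u
        ... | inj₁ refl = contradiction o ¬p
        ... | inj₂ u≡s  = u≡s
        pick : ∀ {w} → Inner w → ∃[ s ] Crossing w s
        pick (inj₁ l~w) with mateˡ l~w
        ... | s , P , r~s = s , pair-~₂ P , only not-l P , inj₁ (l~w , r~s)
        pick (inj₂ r~w) with mateʳ r~w
        ... | s , P , l~s = s , pair-~₂ P , only not-r P , inj₂ (r~w , l~s)
        partner = choose {Q = Crossing} (λ w → T? (adj l w) ⊎-dec T? (adj r w)) pick
        σ = proj₁ partner
        σ-sides : ∀ {w} → Inner w → l ~ w × r ~ σ w ⊎ r ~ w × l ~ σ w
        σ-sides o = proj₂ (proj₂ (proj₂ partner o))
        σ-right : ∀ {w} → l ~ w → r ~ σ w
        σ-right l~w with σ-sides (inj₁ l~w)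
        ... | inj₁ (_ , r~σ)  = r~σ
        ... | inj₂ (r~w , _)  = contradiction r~w (disjoint l~w)
        σ-left : ∀ {w} → r ~ w → l ~ σ w
        σ-left r~w with σ-sides (inj₂ r~w)
        ... | inj₁ (l~w , _)  = contradiction r~w (disjoint l~w)
        ... | inj₂ (_ , l~σ)  = l~σ

      pathMatching : Matching G (λ w → l ~ w ⊎ r ~ w)
      pathMatching = record
        -- The neighbours of l represent the paths: `slot i zero` is joined to l as `inner i zero`
        -- is to `left`, and t is the degree of l.
        { reps      = nbrs l
        ; unique    = nbrs-unique l
        ; σ         = σ
        ; σ-edge    = λ o → proj₁ (proj₂ partner o)
        ; σ-ord     = λ { (inj₁ l~w) → inj₂ (σ-right l~w) ; (inj₂ r~w) → inj₁ (σ-left r~w) }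
        ; σ-only    = λ o → proj₁ (proj₂ (proj₂ partner o))
        ; reps-ord  = inj₁ ∘ ∈⇒~
        ; split     = λ { (inj₁ l~w) → inj₁ (~⇒∈ l~w) ; (inj₂ r~w) → inj₂ (~⇒∈ (σ-left r~w)) }
        ; exclusive = λ w∈ σw∈ → disjoint (∈⇒~ σw∈) (σ-right (∈⇒~ w∈))
        }

      open Matching pathMatching using (t; slot; slot-ord; slot-injective; slot-surjective; slot-adj)

      theta-≅ : G ≅ UniformTheta₂ t
      theta-≅ = ≅-from G (UniformTheta₂ t) from injective surjective adj-eq
        where
        from : ThetaVertex t → Fin n
        from left        = l
        from right       = r
        from (inner i a) = slot i a
        l~slot : ∀ i → l ~ slot i zero
        l~slot i = ∈⇒~ (∈-lookup i)
        r~slot : ∀ i → r ~ slot i (suc zero)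
        r~slot i = σ-right (l~slot i)
        injective : ∀ {p q} → from p ≡ from q → p ≡ q
        injective {left}      {left}      eq = refl
        injective {left}      {right}     eq = contradiction eq l≢r
        injective {left}      {inner j b} eq = contradiction (subst Inner (sym eq) (slot-ord j b)) not-l
        injective {right}     {left}      eq = contradiction (sym eq) l≢r
        injective {right}     {right}     eq = refl
        injective {right}     {inner j b} eq = contradiction (subst Inner (sym eq) (slot-ord j b)) not-r
        injective {inner i a} {left}      eq = contradiction (subst Inner eq (slot-ord i a)) not-l
        injective {inner i a} {right}     eq = contradiction (subst Inner eq (slot-ord i a)) not-r
        injective {inner i a} {inner j b} eq with slot-injective i a j b eq
        ... | refl , refl = refl
        inside : ∀ {v} → Inner v → ∃[ p ] from p ≡ v
        inside o with slot-surjective o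
        ... | i , a , eq = inner i a , eq
        surjective : ∀ v → ∃[ p ] from p ≡ v
        surjective v with cover v
        ... | inj₁ eq        = left , sym eq
        ... | inj₂ (inj₁ eq) = right , sym eq
        ... | inj₂ (inj₂ o)  = inside o
        left-adj : ∀ i a → adj l (slot i a) ≡ thetaAdj (left {t}) (inner i a)
        left-adj i zero       = ≡true (l~slot i)
        left-adj i (suc zero) = ≡false λ l~s → disjoint l~s (r~slot i)
        right-adj : ∀ i a → adj r (slot i a) ≡ thetaAdj (right {t}) (inner i a)
        right-adj i zero       = ≡false (disjoint (l~slot i))
        right-adj i (suc zero) = ≡true (r~slot i)
        adj-eq : ∀ p q → adj (from p) (from q) ≡ thetaAdj p q
        adj-eq left        left        = irrefl l
        adj-eq left        right       = ≡false l≁r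
        adj-eq left        (inner j b) = left-adj j b
        adj-eq right       left        = ≡false (l≁r ∘ ~-sym)
        adj-eq right       right       = irrefl r
        adj-eq right       (inner j b) = right-adj j b
        adj-eq (inner i a) left        = trans (symm (slot i a) l) (left-adj i a)
        adj-eq (inner i a) right       = trans (symm (slot i a) r) (right-adj i a)
        adj-eq (inner i a) (inner j b) = slot-adj i a j b

      isTheta⇒≅ : ∃[ t ] (t ≥ 1 × G ≅ UniformTheta₂ t)
      isTheta⇒≅ = t , ℕ.n≢0⇒n>0 (deg≢0 l) , theta-≅

    -- Local descriptions from the isomorphisms

    module IsomorphicPairs {W : Set} {H : Graph W} (iso : G ≅ H) where
      open Isomorphic {H = H} iso

      from-pair : ∀ p {q r} → q ≢ r → Graph.adj H p q ≡ true → Graph.adj H p r ≡ true →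
        (∀ u → T (Graph.adj H p u) → u ≡ q ⊎ u ≡ r) → Pair (from p) (from q) (from r)
      from-pair p {q} {r} q≢r p~q p~r only = nbrs-↭
        (((λ eq → q≢r (from-injective eq)) ∷ []) ∷ [] ∷ [])
        (λ {u} p~u → member u p~u (preimage u))
        (λ { (here refl) → from-~ p q p~q ; (there (here refl)) → from-~ p r p~r })
        where
        member : ∀ u → from p ~ u → ∃[ u′ ] u ≡ from u′ → u ∈ from q ∷ from r ∷ []
        member _ p~u (u′ , refl) with only u′ (~-from p u′ p~u)
        ... | inj₁ refl = here refl
        ... | inj₂ refl = there (here refl)

    module FromWindmill {t} (iso : G ≅ DutchWindmill t) where
      open Isomorphic {H = DutchWindmill t} iso
      open IsomorphicPairs {H = DutchWindmill t} iso

      isWindmill : IsWindmill (from hub)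
      isWindmill = record { mate = λ {w} → partner (preimage w) }
        where
        only : ∀ i a u → T (windmillAdj (rim i a) u) → u ≡ hub ⊎ u ≡ rim i (other a)
        only i a hub       _ = inj₁ refl
        only i a (rim j b) e with matchedAdj⇒ i a j b e
        ... | refl , refl = inj₂ refl
        partner : ∀ {w} → ∃[ p ] w ≡ from p → w ≢ from hub → ∃[ s ] Pair w (from hub) s
        partner (hub , refl)     w≢h = contradiction refl w≢h
        partner (rim i a , refl) _   = from (rim i (other a)) ,
          from-pair (rim i a) (λ ()) refl (matchedAdj-other i a) (only i a)

      -- Both rim vertices of one blade and one of another are three distinct neighbours.
      hub-deg : t ℕ.≥ 2 → deg (from hub) ≢ 2
      hub-deg (ℕ.s≤s (ℕ.s≤s _)) deg≡2 with pairWith deg≡2 (from-~ hub (rim zero zero) refl)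
      ... | s , P with pair-~ P (from-~ hub (rim zero (suc zero)) refl) | pair-~ P (from-~ hub (rim (suc zero) zero) refl)
      ...   | inj₁ eq  | _        = contradiction (from-injective eq) λ ()
      ...   | inj₂ _   | inj₁ eq  = contradiction (from-injective eq) λ ()
      ...   | inj₂ eq₁ | inj₂ eq₂ = contradiction (from-injective (trans eq₁ (sym eq₂))) λ ()

    module FromTheta {t} (iso : G ≅ UniformTheta₂ t) where
      open Isomorphic {H = UniformTheta₂ t} iso
      open IsomorphicPairs {H = UniformTheta₂ t} iso

      private
        l r : Fin n
        l = from left
        r = from right

      left-pair : ∀ i → Pair (from (inner i zero)) l (from (inner i (suc zero)))
      left-pair i = from-pair (inner i zero) (λ ()) refl (matchedAdj-other i zero) only
        where
        only : ∀ u → T (thetaAdj (inner i zero) u) → u ≡ left ⊎ u ≡ inner i (suc zero)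
        only left        _ = inj₁ refl
        only (inner j b) e with matchedAdj⇒ i zero j b e
        ... | refl , refl = inj₂ refl

      right-pair : ∀ i → Pair (from (inner i (suc zero))) r (from (inner i zero))
      right-pair i = from-pair (inner i (suc zero)) (λ ()) refl (matchedAdj-other i (suc zero)) only
        where
        only : ∀ u → T (thetaAdj (inner i (suc zero)) u) → u ≡ right ⊎ u ≡ inner i zero
        only right       _ = inj₁ refl
        only (inner j b) e with matchedAdj⇒ i (suc zero) j b e
        ... | refl , refl = inj₂ refl

      end-deg : ∀ p a → (∀ i → thetaAdj p (inner i a) ≡ true) → (∀ u → T (thetaAdj p u) → ∃[ i ] u ≡ inner i a) → deg (from p) ≡ t
      end-deg p a edge only = trans (↭-length (nbrs-↭ unique (λ {u} e → member e (preimage u)) member⁻¹))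
        (trans (length-map _ (allFin t)) (length-tabulate id))
        where
        near : Fin t → Fin n
        near i = from (inner i a)
        unique : Unique (map near (allFin t))
        unique = Unique.map⁺ (λ eq → inner-injective (from-injective eq)) (Unique.allFin⁺ t)
          where
          inner-injective : ∀ {i j} → _≡_ {A = ThetaVertex t} (inner i a) (inner j a) → i ≡ j
          inner-injective refl = refl
        member : ∀ {u} → from p ~ u → ∃[ u′ ] u ≡ from u′ → u ∈ map near (allFin t)
        member e (u′ , refl) with only u′ (~-from p u′ e)
        ... | i , refl = ∈-map⁺ near (∈-allFin i)
        member⁻¹ : ∀ {u} → u ∈ map near (allFin t) → from p ~ u
        member⁻¹ u∈ with ∈-map⁻ near u∈
        ... | i , _ , refl = from-~ p (inner i a) (edge i)

      isTheta : IsTheta l r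
      isTheta = record
        { l≢r      = λ eq → contradiction (from-injective eq) λ ()
        ; l≁r      = ~-from left right
        ; cover    = λ w → cover (preimage w)
        ; disjoint = λ {w} → disjoint (preimage w)
        ; mateˡ    = λ {w} → mateˡ (preimage w)
        ; mateʳ    = λ {w} → mateʳ (preimage w)
        ; balanced = cong inv (trans
            (end-deg left zero (λ _ → refl) λ { (inner i zero) _ → i , refl })
            (sym (end-deg right (suc zero) (λ _ → refl) λ { (inner i (suc zero)) _ → i , refl })))
        }
        where
        cover : ∀ {w} → ∃[ p ] w ≡ from p → w ≡ l ⊎ w ≡ r ⊎ l ~ w ⊎ r ~ w
        cover (left , refl)             = inj₁ refl
        cover (right , refl)            = inj₂ (inj₁ refl)
        cover (inner i zero , refl)       = inj₂ (inj₂ (inj₁ (from-~ left (inner i zero) refl)))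
        cover (inner i (suc zero) , refl) = inj₂ (inj₂ (inj₂ (from-~ right (inner i (suc zero)) refl)))
        disjoint : ∀ {w} → ∃[ p ] w ≡ from p → l ~ w → ¬ r ~ w
        disjoint (left , refl)               l~w _   = ~-from left left l~w
        disjoint (right , refl)              l~w _   = ~-from left right l~w
        disjoint (inner i zero , refl)       _   r~w = ~-from right (inner i zero) r~w
        disjoint (inner i (suc zero) , refl) l~w _   = ~-from left (inner i (suc zero)) l~w
        mateˡ : ∀ {w} → ∃[ p ] w ≡ from p → l ~ w → ∃[ s ] Pair w l s × r ~ s
        mateˡ (left , refl)               l~w = ⊥-elim (~-from left left l~w)
        mateˡ (right , refl)              l~w = ⊥-elim (~-from left right l~w)
        mateˡ (inner i zero , refl)       _   = _ , left-pair i , from-~ right (inner i (suc zero)) refl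
        mateˡ (inner i (suc zero) , refl) l~w = ⊥-elim (~-from left (inner i (suc zero)) l~w)
        mateʳ : ∀ {w} → ∃[ p ] w ≡ from p → r ~ w → ∃[ s ] Pair w r s × l ~ s
        mateʳ (left , refl)               r~w = ⊥-elim (~-from right left r~w)
        mateʳ (right , refl)              r~w = ⊥-elim (~-from right right r~w)
        mateʳ (inner i zero , refl)       r~w = ⊥-elim (~-from right (inner i zero) r~w)
        mateʳ (inner i (suc zero) , refl) _   = _ , right-pair i , from-~ left (inner i zero) refl

    -- Classification of the graphs satisfying the kernel condition

    module Classification (conn : ∀ x y → Star _~_ x y) where

      -- By connectedness the graph is K₂. At a leaf the reflection 2 avg - 1 is the identity, so a
      -- step merely reverses the arc.
      edge-component : ∀ {x z} → nbrs x ≡ z ∷ [] → nbrs z ≡ x ∷ [] → PeriodEquation 2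
      edge-component {x} {z} nx nz {w} {v} {u} _ e = involutive (Δ w v) (component (conn x _)) e
        where
        step-leaf : ∀ F {p q} → nbrs p ≡ q ∷ [] → step F p q ≡ F q p
        step-leaf F {p} {q} eq rewrite eq = solve 1 (λ f → con 2ℚ :* (con 1ℚ :* (f :+ con 0ℚ)) :- f := f) refl (F q p)
        only : ∀ {p q u} → nbrs p ≡ q ∷ [] → p ~ u → u ≡ q
        only eq p~u with subst (_ ∈_) eq (~⇒∈ p~u)
        ... | here u≡q = u≡q
        component : ∀ {p} → Star _~_ x p → p ≡ x ⊎ p ≡ z
        componentᶻ : ∀ {p} → Star _~_ z p → p ≡ x ⊎ p ≡ z
        component ε        = inj₁ refl
        component (e ◅ es) with only nx e
        ... | refl = componentᶻ es
        componentᶻ ε        = inj₂ refl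
        componentᶻ (e ◅ es) with only nz e
        ... | refl = component es
        involutive : ∀ F {p q} → p ≡ x ⊎ p ≡ z → p ~ q → steps 2 F p q ≡ F p q
        involutive F (inj₁ refl) p~q with only nx p~q
        ... | refl = trans (step-leaf (step F) nx) (step-leaf F nz)
        involutive F (inj₂ refl) p~q with only nz p~q
        ... | refl = trans (step-leaf (step F) nz) (step-leaf F nx)

      -- At degree 2 the amplitude of turning back is 2/2 - 1 = 0, so the walk passes straight
      -- through. On a triangle it returns after three steps.
      step-pair : ∀ F {x p q} → Pair x p q → step F x p ≡ F q x
      step-pair F {x} {p} {q} P = trans
        (cong₂ (λ i s → 2ℚ * (i * s) - F p x) (pair-I₁ P) (∑-↭ (λ u → F u x) P))
        (solve 2 (λ f g → con 2ℚ :* (con ½ :* (f :+ (g :+ con 0ℚ))) :- f := g) refl (F p x) (F q x))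

      step₃-triangle : ∀ F {p q r} → Pair p q r → Pair q r p → Pair r p q → steps 3 F p q ≡ F p q
      step₃-triangle F P Q R = trans (step-pair (steps 2 F) P) (trans (step-pair (step F) R) (step-pair F Q))

      -- All other vertices being adjacent to z, whose neighbours are x and y, the graph is the
      -- triangle.
      triangle : ∀ {x y z} → Pair x y z → Pair y x z → Pair z x y → (∀ {w} → w ≢ z → z ~ w) → PeriodEquation 3
      triangle {x} {y} {z} Px Py Pz near {w} {v} {u} _ e = case (u ≟ z) e
        where
        F = Δ w v
        fromX : ∀ {u′} → u′ ≡ y ⊎ u′ ≡ z → steps 3 F x u′ ≡ F x u′
        fromX (inj₁ refl) = step₃-triangle F Px (pair-swap Py) Pz
        fromX (inj₂ refl) = step₃-triangle F (pair-swap Px) (pair-swap Pz) Py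
        fromY : ∀ {u′} → u′ ≡ x ⊎ u′ ≡ z → steps 3 F y u′ ≡ F y u′
        fromY (inj₁ refl) = step₃-triangle F Py (pair-swap Px) (pair-swap Pz)
        fromY (inj₂ refl) = step₃-triangle F (pair-swap Py) Pz Px
        fromZ : ∀ {u′} → u′ ≡ x ⊎ u′ ≡ y → steps 3 F z u′ ≡ F z u′
        fromZ (inj₁ refl) = step₃-triangle F Pz Px (pair-swap Py)
        fromZ (inj₂ refl) = step₃-triangle F (pair-swap Pz) Py (pair-swap Px)
        fromRim : ∀ {u u′} → u ≡ x ⊎ u ≡ y → u ~ u′ → steps 3 F u u′ ≡ F u u′
        fromRim (inj₁ refl) e = fromX (pair-~ Px e)
        fromRim (inj₂ refl) e = fromY (pair-~ Py e)
        case : ∀ {u u′} → Dec (u ≡ z) → u ~ u′ → steps 3 F u u′ ≡ F u u′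
        case (yes refl) e = fromZ (pair-~ Pz e)
        case (no u≢z)   e = fromRim (pair-~ Pz (near u≢z)) e

      module Forward (ker : KernelCondition) (¬period2 : ¬ PeriodEquation 2) (¬period3 : ¬ PeriodEquation 3) (v : Fin n) where

        κ-constant : ∀ x y → κ x x ≡ κ y y
        κ-constant x y = along (conn x y)
          where
          along : ∀ {x y} → Star _~_ x y → κ x x ≡ κ y y
          along ε            = refl
          along (x~z ◅ path) = trans (ker (~-sym x~z) (~-sym x~z)) (along path)

        k : ℚ
        k = κ v v

        -- κ only takes the value k on pairs at even distance, and another value on the rest.
        Even : Fin n → Fin n → Set
        Even x y = κ x y ≡ k

        even-refl : ∀ x → Even x x
        even-refl x = κ-constant x v

        even-sym : ∀ {x y} → Even x y → Even y x
        even-sym {x} {y} p = trans (κ-sym y x) p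

        even-common : ∀ {x y u} → x ~ u → y ~ u → Even x y
        even-common {u = u} x~u y~u = trans (ker (~-sym x~u) (~-sym y~u)) (even-refl u)

        even-step : ∀ {x y x′ y′} → Even x y → x ~ x′ → y ~ y′ → Even x′ y′
        even-step p x~x′ y~y′ = trans (ker x~x′ y~y′) p

        -- Along a path to w the partner alternates between x and y. Both alternatives may hold, as
        -- in a windmill.
        even-either : ∀ {x y} → x ~ y → ∀ w → Even x w ⊎ Even y w
        even-either {x} {y} x~y w = along (inj₁ (even-refl x)) (conn x w)
          where
          along : ∀ {w w′} → Even x w ⊎ Even y w → Star _~_ w w′ → Even x w′ ⊎ Even y w′
          along p         ε            = p
          along (inj₁ p) (w~u ◅ path) = along (inj₂ (even-step p x~y w~u)) path
          along (inj₂ p) (w~u ◅ path) = along (inj₁ (even-step p (~-sym x~y) w~u)) path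

        4b-even : ∀ {x y} → x ≢ y → Even x y → 4ℚ * b x y ≡ k * (D x * D y)
        4b-even {x} {y} x≢y p = by₃ (- (4ℚ * b x y * (D y * I₁ y))) (D*I₁ x) (- (4ℚ * b x y)) (D*I₁ y)
          (D x * D y) (trans (sym (κ-≢ x≢y)) p)
          (solve 6 (λ dx dy ix iy s k → con 4ℚ :* s := k :* (dx :* dy)
             :+ (:- (con 4ℚ :* s :* (dy :* iy))) :* (dx :* ix :- con 1ℚ) :+ (:- (con 4ℚ :* s)) :* (dy :* iy :- con 1ℚ)
             :+ dx :* dy :* (con 4ℚ :* (ix :* iy :* s) :- k)) refl
             (D x) (D y) (I₁ x) (I₁ y) (b x y) k)

        -- On the diagonal b x x is the sum of 1/d_u over the neighbours u of x, and the extra `D x`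
        -- comes from the term δ_xy of κ.
        4b-self : ∀ x → 4ℚ * b x x ≡ k * (D x * D x) + D x
        4b-self x = by₂ (D x - 4ℚ * b x x * (D x * I₁ x + 1ℚ)) (D*I₁ x)
          (D x * D x) (trans (sym (κ-self x)) (even-refl x))
          (solve 4 (λ d i s k → con 4ℚ :* s := k :* (d :* d) :+ d
             :+ (d :- con 4ℚ :* s :* (d :* i :+ con 1ℚ)) :* (d :* i :- con 1ℚ)
             :+ d :* d :* (con 4ℚ :* (i :* i :* s) :- i :- k)) refl
             (D x) (I₁ x) (b x x) k)

        -- Without a vertex of degree at least 2 the graph would be K₂, where U² = I.
        branch : ∃[ u ] ∃[ p ] ∃[ q ] p ≢ q × p ~ u × q ~ u
        branch = at v refl
          where
          two : ∀ u {p q ps} → nbrs u ≡ p ∷ q ∷ ps → ∃[ u ] ∃[ p ] ∃[ q ] p ≢ q × p ~ u × q ~ u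
          two u {p} {q} eq with subst Unique eq (nbrs-unique u)
          ... | (p≢q ∷ _) ∷ _ = u , p , q , p≢q , ~-sym (∈⇒~ (subst (p ∈_) (sym eq) (here refl)))
                                                , ~-sym (∈⇒~ (subst (q ∈_) (sym eq) (there (here refl))))
          leafNeighbour : ∀ {x} z {zs} → nbrs x ≡ z ∷ [] → x ∈ zs → nbrs z ≡ zs → ∃[ u ] ∃[ p ] ∃[ q ] p ≢ q × p ~ u × q ~ u
          leafNeighbour z {_ ∷ []}    nx (here refl) eq = ⊥-elim (¬period2 (edge-component nx eq))
          leafNeighbour z {_ ∷ _ ∷ _} nx _           eq = two z eq
          at : ∀ x {xs} → nbrs x ≡ xs → ∃[ u ] ∃[ p ] ∃[ q ] p ≢ q × p ~ u × q ~ u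
          at x {[]}        eq = contradiction (cong length eq) (deg≢0 x)
          at x {z ∷ []}    eq = leafNeighbour z eq (~⇒∈ (~-sym (∈⇒~ (subst (z ∈_) (sym eq) (here refl))))) refl
          at x {_ ∷ _ ∷ _} eq = two x eq

        -- At two distinct neighbours of one vertex κ has no diagonal term and a positive b.
        0<k : 0ℚ < k
        0<k with branch
        ... | u , p , q , p≢q , p~u , q~u = subst (λ r → 0ℚ < r) (trans (sym (κ-≢ p≢q)) (even-common p~u q~u))
          (0<* (positive⁻¹ 4ℚ) (0<* (0<* (0<I₁ p) (0<I₁ q)) (<-≤-trans (0<I₁ u) (I₁≤b p~u q~u))))

        -- By `4b-even` b x y is positive, and it is a sum over common neighbours. This bounds all
        -- even distances by 2.
        common-neighbour : ∀ {x y} → x ≢ y → Even x y → ∃[ u ] x ~ u × y ~ u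
        common-neighbour {x} {y} x≢y p with any? (λ u → T? (adj y u)) (nbrs x)
        ... | yes found with find found
        ...   | u , u∈ , y~u = u , ∈⇒~ u∈ , y~u
        common-neighbour {x} {y} x≢y p | no ¬found = contradiction
          (trans (sym (4b-even x≢y p)) (cong (λ q → 4ℚ * q) (∑-zero (nbrs x) λ u u∈ →
            trans (cong (λ q → q * I₁ u) (ind-≁ (λ y~u → ¬found (lose u∈ y~u)))) (*-zeroˡ (I₁ u)))))
          (λ eq → <-irrefl (sym eq) (0<* 0<k (0<* (0<D x) (0<D y))))

        -- If all neighbours had degree at least 4, then 4 b x x ≤ d_x, but it equals k d_x² + d_x.
        small-neighbour : ∀ x → ∃[ u ] x ~ u × deg u ℕ.≤ 3
        small-neighbour x with any? (λ u → deg u ℕ.≤? 3) (nbrs x)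
        ... | yes found with find found
        ...   | u , u∈ , small = u , ∈⇒~ u∈ , small
        small-neighbour x | no ¬found = ⊥-elim (0<+0≤≢0
          (0<* 0<k (0<* (0<D x) (0<D x))) (0≤* {4ℚ} (nonNegative⁻¹ 4ℚ) (≤⇒0≤- b≤))
          (by₁ (- 1ℚ) (4b-self x) (solve 3 (λ k d s → k :* (d :* d) :+ con 4ℚ :* (d :* con (+ 1 / 4) :- s) :=
              con 0ℚ :+ con (- 1ℚ) :* (con 4ℚ :* s :- (k :* (d :* d) :+ d))) refl k (D x) (b x x))))
          where
          b≤ : b x x ≤ D x * (+ 1 / 4)
          b≤ = subst₂ _≤_ (sym (b-self x)) (∑-const (+ 1 / 4) (nbrs x))
            (∑-mono (nbrs x) λ u u∈ → inv-anti {4} (λ ()) (ℕ.≰⇒> λ small → ¬found (lose u∈ small)))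

        module _ {x y z x′} (Px : Pair x y z) (Py : Pair y x x′) where

          -- `4b-self` at x reads 4 (1/2 + 1/d_z) = 4k + 2.
          far-inverse : I₁ z ≡ k
          far-inverse = by₁ (+ 1 / 4) (trans (cong (λ s → 4ℚ * s) (sym bx)) (trans (4b-self x) (cong (λ d → k * (d * d) + d) (pair-D Px))))
            (solve 2 (λ i k → i := k :+ con (+ 1 / 4) :* (con 4ℚ :* (con ½ :+ i) :- (k :* (con 2ℚ :* con 2ℚ) :+ con 2ℚ))) refl (I₁ z) k)
            where
            bx : b x x ≡ ½ + I₁ z
            bx = trans (b-self x) (trans (∑-↭ I₁ Px) (cong₂ _+_ (pair-I₁ Py) (+-identityʳ (I₁ z))))

          -- Otherwise y and z share both x and x′, and `4b-even` reads 4 (1/2 + 1/d_x′) = 2 k d_z =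
          -- 2.
          far-≁ : ¬ z ~ x′
          far-≁ z~x′ = <-irrefl (sym I₁x′≡0) (0<I₁ x′)
            where
            z~x : z ~ x
            z~x = ~-sym (pair-~₂ Px)
            by : b y z ≡ ½ + I₁ x′
            by = trans (pair-b Py z) (cong₂ _+_
              (trans (cong₂ _*_ (ind-~ z~x) (pair-I₁ Px)) (*-identityˡ ½))
              (trans (cong (λ q → q * I₁ x′) (ind-~ z~x′)) (*-identityˡ (I₁ x′))))
            4by : 4ℚ * (½ + I₁ x′) ≡ I₁ z * (2ℚ * D z)
            4by = trans (cong (λ s → 4ℚ * s) (sym by)) (trans (4b-even (pair-≢ Px) (even-common (pair-~₁ Py) z~x))
              (cong₂ (λ q d → q * (d * D z)) (sym far-inverse) (pair-D Py)))
            I₁x′≡0 : I₁ x′ ≡ 0ℚ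
            I₁x′≡0 = by₂ (+ 1 / 4) 4by ½ (D*I₁ z)
              (solve 3 (λ i j d → i := con 0ℚ :+ con (+ 1 / 4) :* (con 4ℚ :* (con ½ :+ i) :- j :* (con 2ℚ :* d)) :+ con ½ :* (d :* j :- con 1ℚ))
                refl (I₁ x′) (I₁ z) (D z))

          -- The only common neighbour of x and w is z, of weight k, so `4b-even` reads 4k = 2 k
          -- d_w.
          far-neighbour-deg : ∀ {w} → w ≢ x → ¬ w ~ y → z ~ w → deg w ≡ 2
          far-neighbour-deg {w} w≢x w≁y z~w = fromℕ≡2⇒≡2 (deg w) (by₁ 1ℚ (*-zero-product 0<k product)
              (solve 1 (λ d → d := con 2ℚ :+ con 1ℚ :* (d :- con 2ℚ :- con 0ℚ)) refl (D w)))
            where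
            bxw : b x w ≡ k
            bxw = trans (pair-b Px w) (trans (cong₂ _+_
              (trans (cong (λ q → q * I₁ y) (ind-≁ w≁y)) (*-zeroˡ (I₁ y)))
              (trans (cong₂ _*_ (ind-~ (~-sym z~w)) far-inverse) (*-identityˡ k))) (+-identityˡ k))
            product : k * (D w - 2ℚ) ≡ 0ℚ
            product = by₁ (- ½) (trans (cong (λ s → 4ℚ * s) (sym bxw))
                (trans (4b-even (w≢x ∘ sym) (even-common (pair-~₂ Px) (~-sym z~w))) (cong (λ d → k * (d * D w)) (pair-D Px))))
              (solve 2 (λ k d → k :* (d :- con 2ℚ) := con 0ℚ :+ con (- ½) :* (con 4ℚ :* k :- k :* (con 2ℚ :* d))) refl k (D w))

          -- Unless w = x, it shares y or z with x. Sharing y leaves only x′.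
          reach : ∀ {w} → Even x w → w ≡ x′ ⊎ z ~ w
          reach {w} p with w ≟ x
          ... | yes refl = inj₂ (~-sym (pair-~₂ Px))
          ... | no w≢x with common-neighbour (w≢x ∘ sym) p
          ...   | u , x~u , w~u with pair-~ Px x~u
          ...     | inj₂ refl = inj₂ (~-sym w~u)
          ...     | inj₁ refl with pair-~ Py (~-sym w~u)
          ...       | inj₁ w≡x  = contradiction w≡x w≢x
          ...       | inj₂ w≡x′ = inj₁ w≡x′

        -- Both outer neighbours are z, so `reach` from x and from y places every other vertex next
        -- to z. A hub of degree 2 would leave only the triangle.
        fromTriangle : ∀ {x y z} → Pair x y z → Pair y x z → Shape
        fromTriangle {x} {y} {z} Px Py = windmill z (record { mate = λ w≢z → pairWith (rim-deg w≢z) (~-sym (near w≢z)) }) hub-deg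
          where
          near : ∀ {w} → w ≢ z → z ~ w
          near {w} w≢z with even-either (pair-~₁ Px) w
          ... | inj₁ p with reach Px Py p
          ...   | inj₁ w≡z = contradiction w≡z w≢z
          ...   | inj₂ z~w = z~w
          near {w} w≢z | inj₂ p with reach Py Px p
          ...   | inj₁ w≡z = contradiction w≡z w≢z
          ...   | inj₂ z~w = z~w
          rim-deg : ∀ {w} → w ≢ z → deg w ≡ 2
          rim-deg {w} w≢z with w ≟ x
          ... | yes refl = pair-deg Px
          ... | no w≢x = far-neighbour-deg Px Py w≢x w≁y (near w≢z)
            where
            w≁y : ¬ w ~ y
            w≁y w~y with pair-~ Py (~-sym w~y)
            ... | inj₁ w≡x = w≢x w≡x
            ... | inj₂ w≡z = w≢z w≡z
          hub-deg : deg z ≢ 2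
          hub-deg deg≡2 with pairWith deg≡2 (~-sym (pair-~₂ Px))
          ... | s , Pz with pair-~ Pz (~-sym (pair-~₂ Py))
          ...   | inj₁ refl = ~-irrefl (pair-~₁ Px) refl
          ...   | inj₂ refl = ¬period3 (triangle Px Py Pz near)

        module _ {x y z x′} (Px : Pair x y z) (Py : Pair y x x′) (x′≢z : x′ ≢ z) where

          -- Moving both vertices along edges would make z and x `Even`, but they are distinct and
          -- have no common neighbour since x′ ≠ z.
          end-odd : ∀ {w} → z ~ w → ¬ Even w y
          end-odd z~w p with common-neighbour (pair-≢ Py ∘ sym ∘ z≡x) z-even
            where
            z-even : Even z x
            z-even = even-step p (~-sym z~w) (pair-~₁ Py)
            z≡x : z ≡ x → x′ ≡ x
            z≡x refl = ⊥-elim (~-irrefl (pair-~₂ Px) refl)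
          ... | u , z~u , x~u with pair-~ Px x~u
          ...   | inj₂ refl = ~-irrefl z~u refl
          ...   | inj₁ refl with pair-~ Py (~-sym z~u)
          ...     | inj₁ refl = ~-irrefl (pair-~₂ Px) refl
          ...     | inj₂ refl = x′≢z refl

          end-neighbour-deg : ∀ {w} → z ~ w → deg w ≡ 2
          end-neighbour-deg {w} z~w with w ≟ x
          ... | yes refl = pair-deg Px
          ... | no w≢x = far-neighbour-deg Px Py w≢x w≁y z~w
            where
            w≁y : ¬ w ~ y
            w≁y w~y with pair-~ Py (~-sym w~y)
            ... | inj₁ w≡x  = w≢x w≡x
            ... | inj₂ refl = far-≁ Px Py z~w

          -- As w and x share z, the next vertices s and y are `Even`; since s ≠ z, `reach` from y
          -- puts s next to x′.
          end-mate : ∀ {w} → z ~ w → ∃[ s ] Pair w z s × x′ ~ s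
          end-mate {w} z~w with pairWith (end-neighbour-deg z~w) (~-sym z~w)
          ... | s , Pw with reach Py Px (even-sym (even-step (even-common (~-sym z~w) (pair-~₂ Px)) (pair-~₂ Pw) (pair-~₁ Px)))
          ...   | inj₁ s≡z  = contradiction (sym s≡z) (pair-≢ Pw)
          ...   | inj₂ x′~s = s , Pw , x′~s

        -- The outer neighbours become the ends: both have degree 1/k, and parity separates their
        -- neighbourhoods.
        fromPath : ∀ {x y z x′} → Pair x y z → Pair y x x′ → x′ ≢ z → Shape
        fromPath {x} {y} {z} {x′} Px Py x′≢z = theta z x′ record
          { l≢r      = x′≢z ∘ sym
          ; l≁r      = far-≁ Px Py
          ; cover    = cover
          ; disjoint = λ z~w x′~w → end-odd Px Py x′≢z z~w (even-common (~-sym x′~w) (pair-~₂ Py))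
          ; mateˡ    = end-mate Px Py x′≢z
          ; mateʳ    = end-mate Py Px (x′≢z ∘ sym)
          ; balanced = trans (far-inverse Px Py) (sym (far-inverse Py Px))
          }
          where
          cover : ∀ w → w ≡ z ⊎ w ≡ x′ ⊎ z ~ w ⊎ x′ ~ w
          cover w with even-either (pair-~₁ Px) w
          ... | inj₁ p with reach Px Py p
          ...   | inj₁ w≡x′ = inj₂ (inj₁ w≡x′)
          ...   | inj₂ z~w  = inj₂ (inj₂ (inj₁ z~w))
          cover w | inj₂ p with reach Py Px p
          ...   | inj₁ w≡z  = inj₁ w≡z
          ...   | inj₂ x′~w = inj₂ (inj₂ (inj₂ x′~w))

        fromAdjacentPairs : ∀ {x y z x′} → Pair x y z → Pair y x x′ → Shape
        fromAdjacentPairs {z = z} {x′} Px Py with x′ ≟ z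
        ... | yes refl = fromTriangle Px Py
        ... | no x′≢z  = fromPath Px Py x′≢z

        leaf-equation : ∀ {x z} → nbrs x ≡ z ∷ [] → 4ℚ * I₁ z ≡ k + 1ℚ
        leaf-equation {x} {z} nx = trans (cong (λ s → 4ℚ * s) (sym (trans (b-self x)
            (trans (cong (λ l → ∑ l I₁) nx) (+-identityʳ (I₁ z))))))
          (trans (4b-self x) (trans (cong (λ l → k * (fromℕ (length l) * fromℕ (length l)) + fromℕ (length l)) nx)
            (cong (λ q → q + 1ℚ) (*-identityʳ k))))

        -- The other neighbours y of z would have degree 4 and no leaf neighbours, so that b y y ≤ 2 instead of 7/3.
        leaf-cubic : ∀ {x z y} → nbrs x ≡ z ∷ [] → deg z ≡ 3 → z ~ y → y ≢ x → ⊥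
        leaf-cubic {x} {z} {y} nx deg≡3 z~y y≢x = 0<+0≤≢0 (positive⁻¹ (+ 4 / 3)) (0≤* {4ℚ} (nonNegative⁻¹ 4ℚ) (≤⇒0≤- b≤))
            (by₃ (- 1ℚ) (4b-self y) (- (D y * D y)) k≡⅓ (- (+ 1 / 3) * (D y + 1ℚ)) Dy
              (solve 3 (λ d s k → con (+ 4 / 3) :+ con 4ℚ :* (d :* con ½ :- s) := con 0ℚ
                 :+ con (- 1ℚ) :* (con 4ℚ :* s :- (k :* (d :* d) :+ d)) :+ (:- (d :* d)) :* (k :- con (+ 1 / 3))
                 :+ con (- (+ 1 / 3)) :* (d :+ con 1ℚ) :* (d :- con 4ℚ)) refl (D y) (b y y) k))
          where
          x~z : x ~ z
          x~z = ∈⇒~ (subst (z ∈_) (sym nx) (here refl))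
          I₁z : I₁ z ≡ + 1 / 3
          I₁z = cong inv deg≡3
          k≡⅓ : k ≡ + 1 / 3
          k≡⅓ = by₁ (- 1ℚ) (trans (cong (λ i → 4ℚ * i) (sym I₁z)) (leaf-equation nx))
            (solve 1 (λ k → k := con (+ 1 / 3) :+ con (- 1ℚ) :* (con (4ℚ * (+ 1 / 3)) :- (k :+ con 1ℚ))) refl k)
          bxy : b x y ≡ + 1 / 3
          bxy = trans (cong (λ l → ∑ l (λ u → ind (adj y u) * I₁ u)) nx)
            (cong₂ (λ p i → p * i + 0ℚ) (ind-~ (~-sym z~y)) I₁z)
          Dy : D y ≡ 4ℚ
          Dy = by₂ (- 3ℚ) (trans (cong (λ s → 4ℚ * s) (sym bxy)) (trans (4b-even (y≢x ∘ sym) (even-common x~z (~-sym z~y)))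
                 (cong (λ l → k * (fromℕ (length l) * D y)) nx)))
               (- 3ℚ * D y) k≡⅓
               (solve 2 (λ d k → d := con 4ℚ :+ con (- 3ℚ) :* (con (4ℚ * (+ 1 / 3)) :- k :* (con 1ℚ :* d))
                 :+ con (- 3ℚ) :* d :* (k :- con (+ 1 / 3))) refl (D y) k)
          2≤deg : ∀ {u} → y ~ u → 2 ℕ.≤ deg u
          2≤deg {u} y~u with nbrs u in eq | ~⇒∈ (~-sym y~u)
          ... | _ ∷ _ ∷ _ | _         = ℕ.s≤s (ℕ.s≤s ℕ.z≤n)
          ... | _ ∷ []    | here refl = contradiction (trans (trans (sym (D*I₁ y)) (cong (λ d → d * I₁ y) Dy))
                                          (trans (leaf-equation eq) (cong (λ q → q + 1ℚ) k≡⅓))) λ ()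
          b≤ : b y y ≤ D y * ½
          b≤ = subst₂ _≤_ (sym (b-self y)) (∑-const ½ (nbrs y))
            (∑-mono (nbrs y) λ u u∈ → inv-anti {2} (λ ()) (2≤deg (∈⇒~ u∈)))

        -- From 4/d_z = k + 1 > 1 follows d_z ≤ 3. Degree 1 gives K₂, degree 3 falls to
        -- `leaf-cubic`, and for degree 2 the other neighbour of z also has degree 2.
        fromLeaf : ∀ {x z} → nbrs x ≡ z ∷ [] → Shape
        fromLeaf {x} {z} nx = cases (nbrs z) refl
          where
          z~x : z ~ x
          z~x = ~-sym (∈⇒~ (subst (z ∈_) (sym nx) (here refl)))
          I₁x : I₁ x ≡ 1ℚ
          I₁x = cong (inv ∘ length) nx
          onPath : deg z ≡ 2 → Shape
          onPath deg≡2 = proceed (pairWith deg≡2 z~x)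
            where
            proceed : ∃[ s ] Pair z x s → Shape
            proceed (s , Pz) = fromAdjacentPairs (pair-swap Pz) (proj₂ (pairWith s-deg (~-sym (pair-~₂ Pz))))
              where
              bzz : b z z ≡ 1ℚ + I₁ s
              bzz = trans (b-self z) (trans (∑-↭ I₁ Pz) (cong₂ _+_ I₁x (+-identityʳ (I₁ s))))
              -- The leaf equation with d_z = 2 gives k = 1, and then `4b-self` at z reads 4 (1 +
              -- 1/d_s) = 6.
              I₁s : I₁ s ≡ ½
              I₁s = by₂ (+ 1 / 4) (trans (cong (λ q → 4ℚ * q) (sym bzz)) (trans (4b-self z) (cong (λ d → k * (d * d) + d) (pair-D Pz))))
                (- 1ℚ) (trans (cong (λ i → 4ℚ * i) (sym (pair-I₁ Pz))) (leaf-equation nx))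
                (solve 2 (λ i k → i := con ½ :+ con (+ 1 / 4) :* (con 4ℚ :* (con 1ℚ :+ i) :- (k :* con (2ℚ * 2ℚ) :+ con 2ℚ))
                  :+ con (- 1ℚ) :* (con (4ℚ * ½) :- (k :+ con 1ℚ))) refl (I₁ s) k)
              s-deg : deg s ≡ 2
              s-deg = fromℕ≡2⇒≡2 (deg s) (by₁ 2ℚ (trans (sym (cong (λ i → D s * i) I₁s)) (D*I₁ s))
                (solve 1 (λ d → d := con 2ℚ :+ con 2ℚ :* (d :* con ½ :- con 1ℚ)) refl (D s)))
          cases : ∀ l → nbrs z ≡ l → Shape
          cases []           eq = contradiction (cong length eq) (deg≢0 z)
          cases (p ∷ [])     eq with subst (x ∈_) eq (~⇒∈ z~x)
          ... | here refl = ⊥-elim (¬period2 (edge-component nx eq))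
          cases (_ ∷ _ ∷ []) eq = onPath (cong length eq)
          cases (p ∷ q ∷ r ∷ []) eq with p ≟ x
          ... | no p≢x   = ⊥-elim (leaf-cubic nx (cong length eq) (∈⇒~ (subst (p ∈_) (sym eq) (here refl))) p≢x)
          ... | yes refl with subst Unique eq (nbrs-unique z)
          ...   | (p≢q ∷ _) ∷ _ = ⊥-elim (leaf-cubic nx (cong length eq) (∈⇒~ (subst (q ∈_) (sym eq) (there (here refl)))) (p≢q ∘ sym))
          cases (_ ∷ _ ∷ _ ∷ _ ∷ l) eq = ⊥-elim (0<+0≤≢0 0<k
            (0≤* {4ℚ} (nonNegative⁻¹ 4ℚ) (≤⇒0≤- (inv-anti {4} {deg z} (λ ())
              (subst (4 ℕ.≤_) (sym (cong length eq)) (ℕ.s≤s (ℕ.s≤s (ℕ.s≤s (ℕ.s≤s ℕ.z≤n))))))))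
            (by₁ (- 1ℚ) (leaf-equation nx)
              (solve 2 (λ k i → k :+ con 4ℚ :* (con (+ 1 / 4) :- i) := con 0ℚ :+ con (- 1ℚ) :* (con 4ℚ :* i :- (k :+ con 1ℚ))) refl k (I₁ z))))

        -- One of the neighbours of x has degree at most 2, as 4 b y z ≥ 2 forces (D y − 2)(D z − 2) ≤ 0.
        fromPair : ∀ {x y z} → Pair x y z → Shape
        fromPair {x} {y} {z} Px with low Px | low (pair-swap Px)
          where
          low : ∀ {x y z} → Pair x y z → Shape ⊎ 3 ℕ.≤ deg y
          low {x} {y} Px with nbrs y in eq | ~⇒∈ (~-sym (pair-~₁ Px))
          ... | _ ∷ []            | here refl = inj₁ (fromLeaf eq)
          ... | _ ∷ _ ∷ []        | _         = inj₁ (fromAdjacentPairs Px (proj₂ (pairWith (cong length eq) (~-sym (pair-~₁ Px)))))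
          ... | _ ∷ _ ∷ _ ∷ _     | _         = inj₂ (ℕ.s≤s (ℕ.s≤s (ℕ.s≤s ℕ.z≤n)))
        ... | inj₁ shape | _          = shape
        ... | inj₂ _     | inj₁ shape = shape
        ... | inj₂ 3≤y   | inj₂ 3≤z   = ⊥-elim (0<+0≤≢0 (positive⁻¹ 2ℚ)
            (0≤+ (0≤* (nonNegative⁻¹ 2ℚ) 0≤Y) (0≤+ (0≤* (nonNegative⁻¹ 2ℚ) 0≤Z)
              (0≤+ (0≤* (nonNegative⁻¹ 2ℚ) (0≤* 0≤Y 0≤Z)) (0≤* (nonNegative⁻¹ (8ℚ * 2ℚ)) (≤⇒0≤- ½≤b)))))
            (by₂ 4ℚ (4b-even (pair-≢ Px) (even-common (~-sym (pair-~₁ Px)) (~-sym (pair-~₂ Px))))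
              (- (D y * D z)) (trans (cong (λ s → 4ℚ * s) (sym bxx)) (trans (4b-self x) (cong (λ d → k * (d * d) + d) (pair-D Px))))
              (by₂ (4ℚ * D z) (D*I₁ y) (4ℚ * D y) (D*I₁ z)
                (solve 6 (λ Y Z i j s k →
                   con 2ℚ :+ (con 2ℚ :* (Y :- con 3ℚ) :+ (con 2ℚ :* (Z :- con 3ℚ)
                     :+ (con 2ℚ :* ((Y :- con 3ℚ) :* (Z :- con 3ℚ)) :+ con (8ℚ * 2ℚ) :* (s :- con ½)))) :=
                   con 0ℚ :+ con 4ℚ :* (con 4ℚ :* s :- k :* (Y :* Z))
                     :+ (:- (Y :* Z)) :* (con 4ℚ :* (i :+ j) :- (k :* (con 2ℚ :* con 2ℚ) :+ con 2ℚ))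
                     :+ con 4ℚ :* Z :* (Y :* i :- con 1ℚ) :+ con 4ℚ :* Y :* (Z :* j :- con 1ℚ)) refl
                   (D y) (D z) (I₁ y) (I₁ z) (b y z) k))))
          where
          0≤Y : 0ℚ ≤ D y - 3ℚ
          0≤Y = ≤⇒0≤- (fromℕ-mono 3≤y)
          0≤Z : 0ℚ ≤ D z - 3ℚ
          0≤Z = ≤⇒0≤- (fromℕ-mono 3≤z)
          ½≤b : ½ ≤ b y z
          ½≤b = subst (λ i → i ≤ b y z) (pair-I₁ Px) (I₁≤b (~-sym (pair-~₁ Px)) (~-sym (pair-~₂ Px)))
          bxx : b x x ≡ I₁ y + I₁ z
          bxx = trans (b-self x) (trans (∑-↭ I₁ Px) (cong (λ r → I₁ y + r) (+-identityʳ (I₁ z))))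

        fromSmall : ∀ {x} → deg x ℕ.≤ 2 → Shape
        fromSmall {x} deg≤2 = cases (nbrs x) refl
          where
          cases : ∀ l → nbrs x ≡ l → Shape
          cases []                eq = contradiction (cong length eq) (deg≢0 x)
          cases (_ ∷ [])          eq = fromLeaf eq
          cases (_ ∷ _ ∷ [])      eq = fromPair (↭-reflexive eq)
          cases (_ ∷ _ ∷ _ ∷ _)   eq = contradiction (subst (ℕ._≤ 2) (cong length eq) deg≤2) λ { (ℕ.s≤s (ℕ.s≤s ())) }

        -- Suppose the inverse degrees u, v, w of p, q, r are at most 1/3. Then 4 (u + v + w) = 9k +
        -- 3, and k = 4 u v b p q ≥ 4uv/3 since x is a common neighbour of p and q. But 4 (u + v) -
        -- 12uv = 4/3 - 12 (1/3 - u)(1/3 - v) and 4w ≤ 4/3, so at least 1/3 is missing.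
        fromCubic : ∀ {x p q r} → nbrs x ≡ p ∷ q ∷ r ∷ [] → Shape
        fromCubic {x} {p} {q} {r} nx with deg p ℕ.≤? 2 | deg q ℕ.≤? 2 | deg r ℕ.≤? 2
        ... | yes p≤2 | _       | _       = fromSmall p≤2
        ... | _       | yes q≤2 | _       = fromSmall q≤2
        ... | _       | _       | yes r≤2 = fromSmall r≤2
        ... | no p≰2  | no q≰2  | no r≰2  = ⊥-elim (0<+0≤≢0 (positive⁻¹ (+ 1 / 3))
            (0≤+ (0≤* (nonNegative⁻¹ (3ℚ * 4ℚ)) (0≤* (⅓-I₁ p≰2) (⅓-I₁ q≰2))) (0≤+ (0≤* (nonNegative⁻¹ 4ℚ) (⅓-I₁ r≰2))
              (0≤* (nonNegative⁻¹ (+ 36 / 1)) (0≤* (≤⇒0≤- ⅓≤b) (0≤* (0≤inv (deg p)) (0≤inv (deg q)))))))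
            (by₂ (- 1ℚ) (trans (cong (λ s → 4ℚ * s) (sym bxx)) (trans (4b-self x) (cong (λ d → k * (d * d) + d) (cong (fromℕ ∘ length) nx))))
              (+ 9 / 1) (trans (sym (κ-≢ p≢q)) (even-common (~-sym x~p) (~-sym x~q)))
              (solve 5 (λ u v w s k →
                 con (+ 1 / 3) :+ (con (3ℚ * 4ℚ) :* ((con (+ 1 / 3) :- u) :* (con (+ 1 / 3) :- v)) :+ (con 4ℚ :* (con (+ 1 / 3) :- w)
                   :+ con (+ 36 / 1) :* ((s :- con (+ 1 / 3)) :* (u :* v)))) :=
                 con 0ℚ :+ con (- 1ℚ) :* (con 4ℚ :* (u :+ (v :+ w)) :- (k :* (con 3ℚ :* con 3ℚ) :+ con 3ℚ))
                   :+ con (+ 9 / 1) :* (con 4ℚ :* (u :* v :* s) :- k)) refl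
                 (I₁ p) (I₁ q) (I₁ r) (b p q) k)))
          where
          x~p : x ~ p
          x~p = ∈⇒~ (subst (p ∈_) (sym nx) (here refl))
          x~q : x ~ q
          x~q = ∈⇒~ (subst (q ∈_) (sym nx) (there (here refl)))
          p≢q : p ≢ q
          p≢q with subst Unique nx (nbrs-unique x)
          ... | (p≢q ∷ _) ∷ _ = p≢q
          ⅓-I₁ : ∀ {u} → ¬ deg u ℕ.≤ 2 → 0ℚ ≤ + 1 / 3 - I₁ u
          ⅓-I₁ ≰2 = ≤⇒0≤- (inv-anti {3} (λ ()) (ℕ.≰⇒> ≰2))
          ⅓≤b : + 1 / 3 ≤ b p q
          ⅓≤b = subst (λ i → i ≤ b p q) (cong (inv ∘ length) nx) (I₁≤b (~-sym x~p) (~-sym x~q))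
          bxx : b x x ≡ I₁ p + (I₁ q + I₁ r)
          bxx = trans (b-self x) (trans (cong (λ l → ∑ l I₁) nx) (cong (λ s → I₁ p + (I₁ q + s)) (+-identityʳ (I₁ r))))

        shape : Shape
        shape with small-neighbour v
        ... | u , _ , deg≤3 = cases (nbrs u) refl
          where
          cases : ∀ l → nbrs u ≡ l → Shape
          cases []                    eq = contradiction (cong length eq) (deg≢0 u)
          cases (_ ∷ [])              eq = fromLeaf eq
          cases (_ ∷ _ ∷ [])          eq = fromPair (↭-reflexive eq)
          cases (_ ∷ _ ∷ _ ∷ [])      eq = fromCubic eq
          cases (_ ∷ _ ∷ _ ∷ _ ∷ _)   eq = contradiction (subst (ℕ._≤ 3) (cong length eq) deg≤3) λ { (ℕ.s≤s (ℕ.s≤s (ℕ.s≤s ()))) }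

  -- Both directions of the equivalence

  open Evolution

  no-isolated : Connected G → ∀ {u v} → u ~ v → ∀ x → ∃[ y ] x ~ y
  no-isolated (_ , conn) {u} {v} u~v x with conn x u
  ... | ε               = v , u~v
  ... | _◅_ {j = y} e _ = y , e

  Target : Set
  Target = (∃[ t ] (t ≥ 2 × G ≅ DutchWindmill t)) ⊎ (∃[ t ] (t ≥ 1 × G ≅ UniformTheta₂ t))

  shape⇒target : ∀ nbr → Shape nbr → Target
  shape⇒target nbr (windmill h W deg≢2) = inj₁ (isWindmill⇒≅ nbr W deg≢2)
  shape⇒target nbr (theta l r Θ)        = inj₂ (isTheta⇒≅ nbr Θ)

  neighbour-or-isolated : ∀ v → (∃[ y ] v ~ y) ⊎ (∀ {y} → ¬ v ~ y)
  neighbour-or-isolated v with any? (λ y → T? (adj v y)) (allFin n)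
  ... | yes found   = inj₁ (proj₁ (find found) , proj₂ (proj₂ (find found)))
  ... | no isolated = inj₂ λ {y} v~y → isolated (lose (∈-allFin y) v~y)

  -- A connected graph with an isolated vertex has no arcs, so every equation between entries holds
  -- vacuously.
  isolated⇒period1 : ∀ {v} → (∀ x → Star _~_ v x) → (∀ {y} → ¬ v ~ y) → PeriodEquation 1
  isolated⇒period1 {v} conn isolated _ x~y = ⊥-elim (no-edge (conn _) x~y)
    where
    no-edge : ∀ {x y} → Star _~_ v x → ¬ x ~ y
    no-edge ε       = isolated
    no-edge (e ◅ _) = λ _ → isolated e

  periodic⇒¬period : Periodic G 6 → ∀ k → 0 ℕ.< k → k ℕ.< 6 → ¬ PeriodEquation k
  periodic⇒¬period (_ , _ , minimal) k 0<k k<6 per = ℕ.<⇒≱ k<6 (minimal k 0<k (⇒U^≈I k per))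

  periodic⇒target : Connected G → Periodic G 6 → Target
  periodic⇒target G-conn@(v , conn) per@(_ , U⁶≈I , _) = [ proceed , trivial ]′ (neighbour-or-isolated v)
    where
    ¬period : ∀ k → 0 ℕ.< k → k ℕ.< 6 → ¬ PeriodEquation k
    ¬period = periodic⇒¬period per
    trivial : (∀ {y} → ¬ v ~ y) → Target
    trivial isolated = ⊥-elim (¬period 1 (ℕ.<ᵇ⇒< 0 1 _) (ℕ.<ᵇ⇒< 1 6 _) (isolated⇒period1 (conn v) isolated))
    proceed : ∃[ y ] v ~ y → Target
    proceed (_ , v~y) = shape⇒target nbr (Classification.Forward.shape nbr conn (period6⇒kernel nbr (U^≈I⇒ 6 U⁶≈I))
        (¬period 2 (ℕ.<ᵇ⇒< 0 2 _) (ℕ.<ᵇ⇒< 2 6 _)) (¬period 3 (ℕ.<ᵇ⇒< 0 3 _) (ℕ.<ᵇ⇒< 3 6 _)) v)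
      where
      nbr : ∀ x → ∃[ y ] x ~ y
      nbr = no-isolated G-conn v~y

  target⇒periodic : Connected G → Target → Periodic G 6
  target⇒periodic conn (inj₁ (suc t , t≥2 , iso)) =
    period6-minimal nbr (Windmill.kernel nbr W) (Windmill.¬period2 nbr W) (Windmill.¬period3 nbr W (FromWindmill.hub-deg nbr iso t≥2))
    where
    nbr : ∀ x → ∃[ y ] x ~ y
    nbr = no-isolated conn (Isomorphic.from-~ {H = DutchWindmill (suc t)} iso hub (rim zero zero) refl)
    W = FromWindmill.isWindmill nbr iso
  target⇒periodic conn (inj₂ (suc t , _ , iso)) =
    period6-minimal nbr (Theta.kernel nbr Θ) (Theta.¬period2 nbr Θ) (Theta.¬period3 nbr Θ)
    where
    nbr : ∀ x → ∃[ y ] x ~ y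
    nbr = no-isolated conn (Isomorphic.from-~ {H = UniformTheta₂ (suc t)} iso left (inner zero zero) refl)
    Θ = FromTheta.isTheta nbr iso

theorem1p2 : ∀ (n : ℕ) (G : Graph (Fin n)) → Connected G →
    Periodic G 6 ⇔
    ((∃[ t ] (t ≥ 2 × G ≅ DutchWindmill t)) ⊎ (∃[ t ] (t ≥ 1 × G ≅ UniformTheta₂ t)))
theorem1p2 n G conn = mk⇔ (Walk.periodic⇒target G conn) (Walk.target⇒periodic G conn)
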